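{- For every integer $k\geq 1$, the following identity of formal power series in $q$ holds: \[ \sum_{n\geq 0} b(n,k)\, q^n=\frac{1}{1-q}\left(\sum_{t\geq 1} q^{\binom{t}{2}k^2}\,\frac{1-q^{tk^2}}{1-q^{tk}}-1\right). \]
   Context: A partition $\lambda=(\lambda_1\geq\lambda_2\geq\cdots\geq\lambda_r>0)$ of $n$ is identified with its Young diagram. For a cell $u$ of the Young diagram, the hook length $h_u(\lambda)$ is the number of cells $v$ of the diagram with $v=u$, or $v$ below $u$ in the same column, or $v$ to the right of $u$ in the same row. For $k\geq 1$, $\alpha_k(\lambda)$ denotes the number of cells of the Young diagram of $\lambda$ whose hook length equals $k$ (the number of $k$-hooks of $\lambda$). Let $P(n)$ be the set of partitions of $n$ (with $P(0)$ containing only the empty partition), and $b(n,k)=\max\{\alpha_k(\lambda)\colon \lambda\in P(n)\}$. -}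

module Defs where

open import Data.Bool.Base using (if_then_else_)
open import Data.Fin.Base as Fin using (Fin; toℕ)
open import Data.Fin.Properties using (toℕ<n)
open import Data.Integer.Base as ℤ using (ℤ; 0ℤ; 1ℤ)
import Data.Integer.Properties as ℤ
open import Data.List.Base
  using (List; []; _∷_; _++_; cartesianProductWith; filter; length; map; upTo)
open import Data.List.Extrema.Nat using (max; xs≤max; argmax-sel)
open import Data.List.Membership.Propositional using (_∈_)
open import Data.List.Membership.Propositional.Properties
  using (∈-cartesianProductWith⁺; ∈-filter⁺; ∈-filter⁻; ∈-map⁺; ∈-map⁻; ∈-upTo⁺)
open import Data.List.Relation.Unary.All as All using (All; []; _∷_)
open import Data.List.Relation.Unary.Any using (here; there)
open import Data.List.Relation.Unary.Linked as Linked using (Linked)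
open import Data.Nat.Base
  using (ℕ; zero; suc; _+_; _*_; _∸_; _^_; _≤_; _<_; _≥_; z≤n; s≤s; NonZero)
open import Data.Nat.Combinatorics using (_C_; nC1≡n; nCk+nC[k+1]≡[n+1]C[k+1])
open import Data.Nat.ListAction using (sum)
open import Data.Nat.Properties as ℕ using (_≟_; _≤?_; _<?_; _≥?_)
open import Data.Product.Base using (∃-syntax; _×_; _,_; proj₁; proj₂; map₁)
open import Data.Product.Properties using (≡-dec)
open import Data.Sum.Base using (_⊎_; inj₁; inj₂)
open import Data.Vec.Base as Vec using (Vec)
open import Function.Base using (_∘_)
open import Function.Bundles using (_⇔_; mk⇔; module Equivalence)
open import Relation.Binary.PropositionalEquality
  using (_≡_; refl; sym; trans; cong; cong₂; subst; module ≡-Reasoning)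
open import Relation.Nullary using (Dec; does)
open import Relation.Nullary.Decidable using (_×-dec_; _⊎-dec_; dec-false)

open import Algebra.Properties.CommutativeMonoid.Sum ℤ.+-0-commutativeMonoid
  using (sum-syntax; sum⁺-syntax)

-- A partition is the list of its parts λ₁ ≥ λ₂ ≥ ⋯ ≥ λᵣ > 0.

IsPartition : ℕ → List ℕ → Set
IsPartition n ps = Linked _≥_ ps × All (0 <_) ps × sum ps ≡ n

isPartition? : ∀ n ps → Dec (IsPartition n ps)
isPartition? n ps =
  Linked.linked? _≥?_ ps ×-dec (All.all? (0 <?_) ps ×-dec (sum ps ≟ n))

boundedLists : (l m : ℕ) → List (List ℕ)
boundedLists zero    m = [] ∷ []
boundedLists (suc l) m =
  [] ∷ cartesianProductWith _∷_ (upTo (suc m)) (boundedLists l m)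

-- A partition of n has at most n parts, each at most n, so nothing is lost by
-- searching boundedLists n n; see ∈-P.

P : ℕ → List (List ℕ)
P n = filter (isPartition? n) (boundedLists n n)

-- A cell is a pair (row , column), both counted from 0; rows are numbered
-- from top to bottom and columns from left to right.

Cell : Set
Cell = ℕ × ℕ

cells : List ℕ → List Cell
cells []       = []
cells (p ∷ ps) = map (0 ,_) (upTo p) ++ map (map₁ suc) (cells ps)

InHook : Cell → Cell → Set
InHook u v = v ≡ u
           ⊎ (proj₂ v ≡ proj₂ u × proj₁ u < proj₁ v)
           ⊎ (proj₁ v ≡ proj₁ u × proj₂ u < proj₂ v)

inHook? : ∀ u v → Dec (InHook u v)
inHook? u v = ≡-dec _≟_ _≟_ v u
      ⊎-dec ((proj₂ v ≟ proj₂ u ×-dec proj₁ u <? proj₁ v)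
      ⊎-dec  (proj₁ v ≟ proj₁ u ×-dec proj₂ u <? proj₂ v))

hookLength : List ℕ → Cell → ℕ
hookLength ps u = length (filter (inHook? u) (cells ps))

α : ℕ → List ℕ → ℕ
α k ps = length (filter (λ u → hookLength ps u ≟ k) (cells ps))

-- The base value 0 of the library's max is harmless, since P n is nonempty;
-- see b-isMax.

b : ℕ → ℕ → ℕ
b n k = max 0 (map (α k) (P n))

PowerSeries : Set
PowerSeries = ℕ → ℤ

infix  4 _≈_
infixl 6 _⊖_
infixl 7 _⊛_ _⊘_
infix  8 q^_

_≈_ : PowerSeries → PowerSeries → Set
f ≈ g = ∀ n → f n ≡ g n

q^_ : ℕ → PowerSeries
(q^ m) n = if does (n ≟ m) then 1ℤ else 0ℤ

𝟙 : PowerSeries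
𝟙 = q^ 0

_⊖_ : PowerSeries → PowerSeries → PowerSeries
(f ⊖ g) n = f n ℤ.- g n

_⊛_ : PowerSeries → PowerSeries → PowerSeries
(f ⊛ g) n = ∑[ i ≤ n ] (f (toℕ i) ℤ.* g (n ∸ toℕ i))

-- Coefficients of the inverse of a series with constant term 1, from
--   c₀ = 1,  cₙ = − (f₁ cₙ₋₁ + f₂ cₙ₋₂ + ⋯ + fₙ c₀).
-- The value of invPrefix f n is cₙ₋₁ , … , c₁ , c₀.

invNext : PowerSeries → ∀ n → Vec ℤ n → ℤ
invNext f zero    cs = 1ℤ
invNext f (suc n) cs =
  ℤ.- (∑[ i ≤ n ] (f (suc (toℕ i)) ℤ.* Vec.lookup cs i))

invPrefix : PowerSeries → ∀ n → Vec ℤ n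
invPrefix f zero    = Vec.[]
invPrefix f (suc n) = invNext f n (invPrefix f n) Vec.∷ invPrefix f n

-- Meaningful only when f 0 ≡ 1ℤ; see ⊛-inverseʳ.

inv : PowerSeries → PowerSeries
inv f n = Vec.head (invPrefix f (suc n))

_⊘_ : PowerSeries → PowerSeries → PowerSeries
f ⊘ g = f ⊛ inv g

-- An infinite sum of series exists when each coefficient vanishes in all but
-- finitely many terms; its value does not depend on the chosen bound, see
-- ∑∞-limit.

record Summable (F : ℕ → PowerSeries) : Set where
  field
    bound  : ℕ → ℕ
    vanish : ∀ n t → bound n ≤ t → F t n ≡ 0ℤ

open Summable

∑∞ : (F : ℕ → PowerSeries) → Summable F → PowerSeries
∑∞ F s n = ∑[ t < bound s n ] F (toℕ t) n

∑≥1 : (F : ℕ → PowerSeries) → Summable (F ∘ suc) → PowerSeries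
∑≥1 F = ∑∞ (F ∘ suc)

private

  ∈-boundedLists : ∀ l m ps → length ps ≤ l → All (_≤ m) ps →
                   ps ∈ boundedLists l m
  ∈-boundedLists zero    m []       _         _          = here refl
  ∈-boundedLists (suc l) m []       _         _          = here refl
  ∈-boundedLists (suc l) m (p ∷ ps) (s≤s len) (p≤m ∷ ≤m) = there
    (∈-cartesianProductWith⁺ _∷_ (∈-upTo⁺ (s≤s p≤m)) (∈-boundedLists l m ps len ≤m))

  length≤sum : ∀ {ps} → All (0 <_) ps → length ps ≤ sum ps
  length≤sum []         = z≤n
  length≤sum (0<p ∷ ps) = ℕ.+-mono-≤ 0<p (length≤sum ps)

  parts≤sum : ∀ ps → All (_≤ sum ps) ps
  parts≤sum []       = []
  parts≤sum (p ∷ ps) = ℕ.m≤m+n p (sum ps)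
    ∷ All.map (λ x≤ → ℕ.≤-trans x≤ (ℕ.m≤n+m (sum ps) p)) (parts≤sum ps)

∈-P : ∀ n ps → ps ∈ P n ⇔ IsPartition n ps
∈-P n ps = mk⇔ (proj₂ ∘ ∈-filter⁻ (isPartition? n) {xs = boundedLists n n}) complete
  where
  complete : IsPartition n ps → ps ∈ P n
  complete isP@(_ , pos , refl) = ∈-filter⁺ (isPartition? n)
    (∈-boundedLists n n ps (length≤sum pos) (parts≤sum ps)) isP

private

  replicate-isPartition : ∀ n → ∃[ ps ] IsPartition n ps
  replicate-isPartition zero    = [] , Linked.[] , [] , refl
  replicate-isPartition (suc n) =
    suc n ∷ [] , Linked.[-] , s≤s z≤n ∷ [] , ℕ.+-identityʳ (suc n)

b-isMax : ∀ n k → (∀ ps → IsPartition n ps → α k ps ≤ b n k)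
                × (∃[ ps ] IsPartition n ps × α k ps ≡ b n k)
b-isMax n k = upper , attained
  where
  upper : ∀ ps → IsPartition n ps → α k ps ≤ b n k
  upper ps isP = All.lookup (xs≤max 0 (map (α k) (P n)))
    (∈-map⁺ (α k) (Equivalence.from (∈-P n ps) isP))

  attained : ∃[ ps ] IsPartition n ps × α k ps ≡ b n k
  attained with argmax-sel (λ x → x) 0 (map (α k) (P n))
  ... | inj₁ b≡0 with replicate-isPartition n
  ...   | ps , isP = ps , isP ,
          trans (ℕ.n≤0⇒n≡0 (subst (α k ps ≤_) b≡0 (upper ps isP))) (sym b≡0)
  attained | inj₂ b∈ with ∈-map⁻ (α k) b∈
  ... | ps , ps∈P , b≡ = ps , Equivalence.to (∈-P n ps) ps∈P , sym b≡

private

  sum-cong : ∀ n {f g : Fin n → ℤ} → (∀ i → f i ≡ g i) →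
             sum-syntax n f ≡ sum-syntax n g
  sum-cong zero    eq = refl
  sum-cong (suc n) eq = cong₂ ℤ._+_ (eq Fin.zero) (sum-cong n (eq ∘ Fin.suc))

  sum-zero : ∀ n {f : Fin n → ℤ} → (∀ i → f i ≡ 0ℤ) → sum-syntax n f ≡ 0ℤ
  sum-zero zero    eq = refl
  sum-zero (suc n) eq = cong₂ ℤ._+_ (eq Fin.zero) (sum-zero n (eq ∘ Fin.suc))

  lookup-invPrefix : ∀ f n (i : Fin (suc n)) →
                     Vec.lookup (invPrefix f (suc n)) i ≡ inv f (n ∸ toℕ i)
  lookup-invPrefix f n       Fin.zero    = refl
  lookup-invPrefix f (suc n) (Fin.suc i) = lookup-invPrefix f n i

⊛-inverseʳ : ∀ f → f 0 ≡ 1ℤ → f ⊛ inv f ≈ 𝟙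
⊛-inverseʳ f f₀≡1 zero    rewrite f₀≡1 = refl
⊛-inverseʳ f f₀≡1 (suc n) rewrite f₀≡1 = begin
  1ℤ ℤ.* (ℤ.- S) ℤ.+ S′  ≡⟨ cong (ℤ._+ S′) (ℤ.*-identityˡ (ℤ.- S)) ⟩
  ℤ.- S ℤ.+ S′           ≡⟨ cong (ℤ._+_ (ℤ.- S)) (sym S≡S′) ⟩
  ℤ.- S ℤ.+ S            ≡⟨ ℤ.+-inverseˡ S ⟩
  0ℤ                     ∎
  where
  open ≡-Reasoning
  S S′ : ℤ
  S  = ∑[ i ≤ n ] (f (suc (toℕ i)) ℤ.* Vec.lookup (invPrefix f (suc n)) i)
  S′ = ∑[ i ≤ n ] (f (suc (toℕ i)) ℤ.* inv f (n ∸ toℕ i))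
  S≡S′ : S ≡ S′
  S≡S′ = sum-cong (suc n)
    (λ i → cong (f (suc (toℕ i)) ℤ.*_) (lookup-invPrefix f n i))

1-qᵐ-constant : ∀ m .{{_ : NonZero m}} → (𝟙 ⊖ q^ m) 0 ≡ 1ℤ
1-qᵐ-constant (suc m) = refl

private

  sum-stable : ∀ (g : ℕ → ℤ) m N → m ≤ N → (∀ t → m ≤ t → g t ≡ 0ℤ) →
               (∑[ t < N ] g (toℕ t)) ≡ (∑[ t < m ] g (toℕ t))
  sum-stable g zero    N       _         z = sum-zero N (λ i → z (toℕ i) z≤n)
  sum-stable g (suc m) (suc N) (s≤s m≤N) z =
    cong (ℤ._+_ (g 0)) (sum-stable (g ∘ suc) m N m≤N (λ t m≤t → z (suc t) (s≤s m≤t)))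

∑∞-limit : ∀ F (s : Summable F) n N → bound s n ≤ N →
           (∑[ t < N ] F (toℕ t) n) ≡ ∑∞ F s n
∑∞-limit F s n N le = sum-stable (λ t → F t n) (bound s n) N le (vanish s n)

term : ℕ → ℕ → PowerSeries
term k t = q^ ((t C 2) * k ^ 2) ⊛ ((𝟙 ⊖ q^ (t * k ^ 2)) ⊘ (𝟙 ⊖ q^ (t * k)))

private

  q^-small : ∀ m n → n < m → (q^ m) n ≡ 0ℤ
  q^-small m n n<m =
    cong (if_then 1ℤ else 0ℤ) (dec-false (n ≟ m) (ℕ.<⇒≢ n<m))

  q^⊛-small : ∀ m g n → n < m → (q^ m ⊛ g) n ≡ 0ℤ
  q^⊛-small m g n n<m = sum-zero (suc n) λ i →
    cong (ℤ._* g (n ∸ toℕ i))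
         (q^-small m (toℕ i) (ℕ.≤-<-trans (ℕ.≤-pred (toℕ<n i)) n<m))

  t≤[1+t]C2 : ∀ t → t ≤ suc t C 2
  t≤[1+t]C2 t = begin
    t              ≡⟨ sym (nC1≡n t) ⟩
    t C 1          ≤⟨ ℕ.m≤m+n (t C 1) (t C 2) ⟩
    t C 1 + t C 2  ≡⟨ nCk+nC[k+1]≡[n+1]C[k+1] t 1 ⟩
    suc t C 2      ∎
    where open ℕ.≤-Reasoning

term-summable : ∀ k .{{_ : NonZero k}} → Summable (term k ∘ suc)
term-summable k = record
  { bound  = suc
  ; vanish = λ n t n<t → q^⊛-small
      ((suc t C 2) * k ^ 2) ((𝟙 ⊖ q^ (suc t * k ^ 2)) ⊘ (𝟙 ⊖ q^ (suc t * k))) n (ℕ.<-≤-trans n<t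
      (ℕ.≤-trans (t≤[1+t]C2 t) (ℕ.m≤m*n (suc t C 2) (k ^ 2) {{ℕ.m^n≢0 k 2}})))
  }

{-# OPTIONS --safe #-}
module Submission where

-- Encode a partition with parts λ₁ ≥ ⋯ ≥ λᵣ by its beta-set of beads
-- x = λᵢ + r − i; the hooks of length k are the beads x ≥ k such that x − k is
-- a gap.  If the residue class of x mod k holds ρ beads and h hook beads below
-- x, then each of these hook beads has its own gap below x, so x is at least
-- x % k + k ρ, and at least x % k + k ρ + k (h + 1) if x is itself a hook bead.
-- Both x % k + k ρ (over all beads) and x % k + k h (over the hook beads) take
-- distinct values, and a monotone function f summed over m distinct naturals
-- is at least f 0 + ⋯ + f (m − 1).  Hence a partition with m hooks of length k
-- has size at least e m = Σ_{i<m} k (⌊i/k⌋ + 1).  Conversely, staircases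
-- on the runners of the k-abacus give a partition with at least m such hooks
-- for every size n ≥ e m.  So m ≤ b n k if and only if e m ≤ n.
-- On the other side, e (t k + j) = C(t+1,2) k² + j (t+1) k for j ≤ k, so the
-- series in brackets, with its −1, is Σ_{m≥1} q^(e m), and division by 1 − q
-- counts the m ≥ 1 with e m ≤ n.

open import Defs
open import Data.Bool.Base using (if_then_else_)
open import Data.Fin.Base using (toℕ)
open import Data.Fin.Properties using (toℕ<n)
open import Data.Integer.Base as ℤ using (ℤ; 0ℤ; 1ℤ)
import Data.Integer.Properties as ℤ
import Data.Integer.Tactic.RingSolver as ℤ
open import Data.List.Base
  using (List; []; _∷_; _++_; applyDownFrom; downFrom; filter; length; map; upTo)
open import Data.List.Membership.Propositional using (_∈_; _∉_)
open import Data.List.Membership.Propositional.Properties using (∈-++⁻; ∈-∃++)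
open import Data.List.Properties
  using (++-assoc; filter-accept; filter-all; filter-none; filter-reject; filter-++;
         length-++; length-applyDownFrom; length-upTo; map-id; map-upTo)
open import Data.List.Relation.Binary.Permutation.Propositional using (_↭_; ↭⇒↭ₛ)
open import Data.List.Relation.Binary.Permutation.Propositional.Properties
  using (All-resp-↭; ↭-length)
  renaming (map⁺ to ↭-map⁺; shift to ↭-shift)
open import Data.List.Relation.Binary.Permutation.Setoid.Properties using (Unique-resp-↭)
open import Data.List.Relation.Unary.All as All using (All; []; _∷_)
import Data.List.Relation.Unary.All.Properties as All
open import Data.List.Relation.Unary.AllPairs as AllPairs using (AllPairs; []; _∷_)
import Data.List.Relation.Unary.AllPairs.Properties as AllPairs
open import Data.List.Relation.Unary.Any using (here; there)
open import Data.List.Relation.Unary.Linked.Properties using (AllPairs⇒Linked; Linked⇒AllPairs)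
open import Data.List.Relation.Unary.Unique.Propositional using (Unique)
open import Data.Nat.Base
open import Data.Nat.Combinatorics using (_C_; nC1≡n; nCk+nC[k+1]≡[n+1]C[k+1])
open import Data.Nat.DivMod
open import Data.Nat.Divisibility using (divides-refl)
open import Data.Nat.ListAction using (sum)
open import Data.Nat.ListAction.Properties using (sum-++; sum-↭)
open import Data.Nat.Properties as ℕ
  using (_≟_; _≤?_; _<?_; ≤-trans; ≤-refl; ≤-reflexive; +-suc; +-comm; +-assoc)
open import Data.List.Membership.DecPropositional _≟_ using (_∈?_)
open import Data.Nat.Tactic.RingSolver using (solve-∀)
open import Data.Product.Base using (∃-syntax; _×_; _,_; proj₁; proj₂; map₁)
open import Data.Sum.Base using (_⊎_; inj₁; inj₂)
open import Function.Base using (_∘_; id; flip)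
open import Level using (0ℓ)
open import Relation.Binary.Definitions using (tri<; tri≈; tri>)
open import Relation.Binary.PropositionalEquality
open import Relation.Nullary using (¬_; Dec; yes; no; contradiction)
open import Relation.Nullary.Decidable using (_×-dec_; ¬?; dec-false; dec-true)
open import Relation.Unary using (Pred; Decidable; _⊆_)

open import Algebra.Properties.CommutativeMonoid.Sum ℤ.+-0-commutativeMonoid
  using (sum-syntax; sum-cong-≗; ∑-distrib-+)

-- Hook lengths and beads

module _ {A : Set} {P : Pred A 0ℓ} (P? : Decidable P) where

  length-filter-map : ∀ {B : Set} (f : B → A) xs →
    length (filter P? (map f xs)) ≡ length (filter (P? ∘ f) xs)
  length-filter-map f []       = refl
  length-filter-map f (x ∷ xs) with P? (f x)
  ... | yes _ = cong suc (length-filter-map f xs)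
  ... | no  _ = length-filter-map f xs

  length-filter-cong : ∀ {Q : Pred A 0ℓ} (Q? : Decidable Q) {xs} →
    All (λ x → (P x → Q x) × (Q x → P x)) xs →
    length (filter P? xs) ≡ length (filter Q? xs)
  length-filter-cong Q? []                         = refl
  length-filter-cong Q? {x ∷ xs} ((p⇒q , q⇒p) ∷ eqs) with P? x | Q? x
  ... | yes _ | yes _ = cong suc (length-filter-cong Q? eqs)
  ... | yes p | no ¬q = contradiction (p⇒q p) ¬q
  ... | no ¬p | yes q = contradiction (q⇒p q) ¬p
  ... | no _  | no _  = length-filter-cong Q? eqs

  length-filter-mono : ∀ {Q : Pred A 0ℓ} (Q? : Decidable Q) → P ⊆ Q → ∀ xs →
    length (filter P? xs) ≤ length (filter Q? xs)
  length-filter-mono Q? P⊆Q []       = z≤n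
  length-filter-mono Q? P⊆Q (x ∷ xs) with P? x | Q? x
  ... | yes _ | yes _ = s≤s (length-filter-mono Q? P⊆Q xs)
  ... | yes p | no ¬q = contradiction (P⊆Q p) ¬q
  ... | no _  | yes _ = ℕ.m≤n⇒m≤1+n (length-filter-mono Q? P⊆Q xs)
  ... | no _  | no _  = length-filter-mono Q? P⊆Q xs

  length-filter-complement : ∀ xs →
    length (filter P? xs) + length (filter (¬? ∘ P?) xs) ≡ length xs
  length-filter-complement []       = refl
  length-filter-complement (x ∷ xs) with P? x
  ... | yes _ = cong suc (length-filter-complement xs)
  ... | no _  = trans (+-suc _ _) (cong suc (length-filter-complement xs))

upTo-suc : ∀ n → upTo (suc n) ≡ 0 ∷ map suc (upTo n)
upTo-suc n = cong (0 ∷_) (sym (map-upTo suc n))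

count-≥-upTo : ∀ j n → length (filter (j ≤?_) (upTo n)) ≡ n ∸ j
count-≥-upTo zero n = trans
  (cong length (filter-all (0 ≤?_) {upTo n} (All.tabulate λ _ → z≤n))) (length-upTo n)
count-≥-upTo (suc j) zero = refl
count-≥-upTo (suc j) (suc n) = begin
  length (filter (suc j ≤?_) (upTo (suc n)))
    ≡⟨ cong (length ∘ filter (suc j ≤?_)) (upTo-suc n) ⟩
  length (filter (suc j ≤?_) (0 ∷ map suc (upTo n)))
    ≡⟨ length-filter-map (suc j ≤?_) suc (upTo n) ⟩
  length (filter (λ i → suc j ≤? suc i) (upTo n))
    ≡⟨ length-filter-cong (λ i → suc j ≤? suc i) (j ≤?_)
         (All.tabulate {xs = upTo n} λ _ → s≤s⁻¹ , s≤s) ⟩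
  length (filter (j ≤?_) (upTo n))
    ≡⟨ count-≥-upTo j n ⟩
  n ∸ j ∎
  where open ≡-Reasoning

-- The right side is the indicator of `j < n`, written as a filter of a singleton so that
-- `columnLength` can join it to the count over the lower rows.
count-≡-upTo : ∀ j n → length (filter (_≟ j) (upTo n)) ≡ length (filter (j <?_) (n ∷ []))
count-≡-upTo j zero = refl
count-≡-upTo zero (suc n) = begin
  length (filter (_≟ 0) (upTo (suc n)))
    ≡⟨ cong (length ∘ filter (_≟ 0)) (upTo-suc n) ⟩
  suc (length (filter (_≟ 0) (map suc (upTo n))))
    ≡⟨ cong suc (length-filter-map (_≟ 0) suc (upTo n)) ⟩
  suc (length (filter (λ i → suc i ≟ 0) (upTo n)))
    ≡⟨ cong (suc ∘ length) (filter-none (λ i → suc i ≟ 0) {upTo n} (All.tabulate λ _ ())) ⟩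
  1 ∎
  where open ≡-Reasoning
count-≡-upTo (suc j) (suc n) = begin
  length (filter (_≟ suc j) (upTo (suc n)))
    ≡⟨ cong (length ∘ filter (_≟ suc j)) (upTo-suc n) ⟩
  length (filter (_≟ suc j) (map suc (upTo n)))
    ≡⟨ length-filter-map (_≟ suc j) suc (upTo n) ⟩
  length (filter (λ i → suc i ≟ suc j) (upTo n))
    ≡⟨ length-filter-cong (λ i → suc i ≟ suc j) (_≟ j)
         (All.tabulate {xs = upTo n} λ _ → ℕ.suc-injective , cong suc) ⟩
  length (filter (_≟ j) (upTo n))
    ≡⟨ count-≡-upTo j n ⟩
  length (filter (j <?_) (n ∷ []))
    ≡⟨ length-filter-cong (j <?_) ((suc j <?_) ∘ suc) {n ∷ []} ((s≤s , s≤s⁻¹) ∷ []) ⟩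
  length (filter ((suc j <?_) ∘ suc) (n ∷ []))
    ≡⟨ length-filter-map (suc j <?_) suc (n ∷ []) ⟨
  length (filter (suc j <?_) (suc n ∷ [])) ∎
  where open ≡-Reasoning

columnLength : ∀ j ps →
  length (filter (λ v → proj₂ v ≟ j) (cells ps)) ≡ length (filter (j <?_) ps)
columnLength j []       = refl
columnLength j (p ∷ ps) = begin
  length (filter (λ v → proj₂ v ≟ j) (cells (p ∷ ps)))
    ≡⟨ cong length (filter-++ (λ v → proj₂ v ≟ j) (map (0 ,_) (upTo p)) _) ⟩
  length (filter (λ v → proj₂ v ≟ j) (map (0 ,_) (upTo p)) ++
          filter (λ v → proj₂ v ≟ j) (map (map₁ suc) (cells ps)))
    ≡⟨ length-++ (filter (λ v → proj₂ v ≟ j) (map (0 ,_) (upTo p))) ⟩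
  length (filter (λ v → proj₂ v ≟ j) (map (0 ,_) (upTo p))) +
  length (filter (λ v → proj₂ v ≟ j) (map (map₁ suc) (cells ps)))
    ≡⟨ cong₂ _+_ (length-filter-map (λ v → proj₂ v ≟ j) (0 ,_) (upTo p))
                 (length-filter-map (λ v → proj₂ v ≟ j) (map₁ suc) (cells ps)) ⟩
  length (filter (_≟ j) (upTo p)) + length (filter (λ v → proj₂ v ≟ j) (cells ps))
    ≡⟨ cong₂ _+_ (count-≡-upTo j p) (columnLength j ps) ⟩
  length (filter (j <?_) (p ∷ [])) + length (filter (j <?_) ps)
    ≡⟨ length-++ (filter (j <?_) (p ∷ [])) ⟨
  length (filter (j <?_) (p ∷ []) ++ filter (j <?_) ps)
    ≡⟨ cong length (filter-++ (j <?_) (p ∷ []) ps) ⟨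
  length (filter (j <?_) (p ∷ ps)) ∎
  where open ≡-Reasoning

hookLength-split : ∀ p ps u → hookLength (p ∷ ps) u ≡
  length (filter (λ j → inHook? u (0 , j)) (upTo p)) +
  length (filter (λ v → inHook? u (map₁ suc v)) (cells ps))
hookLength-split p ps u = begin
  hookLength (p ∷ ps) u
    ≡⟨ cong length (filter-++ (inHook? u) (map (0 ,_) (upTo p)) _) ⟩
  length (filter (inHook? u) (map (0 ,_) (upTo p)) ++
          filter (inHook? u) (map (map₁ suc) (cells ps)))
    ≡⟨ length-++ (filter (inHook? u) (map (0 ,_) (upTo p))) ⟩
  length (filter (inHook? u) (map (0 ,_) (upTo p))) +
  length (filter (inHook? u) (map (map₁ suc) (cells ps)))
    ≡⟨ cong₂ _+_ (length-filter-map (inHook? u) (0 ,_) (upTo p))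
                 (length-filter-map (inHook? u) (map₁ suc) (cells ps)) ⟩
  _ ∎
  where open ≡-Reasoning

-- Hooks extend only to the right and downwards, so a new top row meets no hook of a cell below it.
hookLength-below : ∀ p ps u → hookLength (p ∷ ps) (map₁ suc u) ≡ hookLength ps u
hookLength-below p ps u@(i , j) = begin
  hookLength (p ∷ ps) (map₁ suc u)
    ≡⟨ hookLength-split p ps (map₁ suc u) ⟩
  length (filter (λ l → inHook? (suc i , j) (0 , l)) (upTo p)) +
  length (filter (λ v → inHook? (suc i , j) (map₁ suc v)) (cells ps))
    ≡⟨ cong₂ _+_
         (cong length (filter-none (λ l → inHook? (suc i , j) (0 , l)) {upTo p}
           (All.tabulate λ _ → above)))
         (length-filter-cong (λ v → inHook? (suc i , j) (map₁ suc v)) (inHook? u)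
           (All.tabulate {xs = cells ps} λ _ → down , up)) ⟩
  hookLength ps u ∎
  where
  open ≡-Reasoning
  above : ∀ {l} → ¬ InHook (suc i , j) (0 , l)
  above (inj₁ ())
  above (inj₂ (inj₁ (_ , ())))
  above (inj₂ (inj₂ (() , _)))
  down : ∀ {v} → InHook (suc i , j) (map₁ suc v) → InHook u v
  down (inj₁ refl)                = inj₁ refl
  down (inj₂ (inj₁ (eq , s≤s lt))) = inj₂ (inj₁ (eq , lt))
  down (inj₂ (inj₂ (eq , lt)))     = inj₂ (inj₂ (ℕ.suc-injective eq , lt))
  up : ∀ {v} → InHook u v → InHook (suc i , j) (map₁ suc v)
  up (inj₁ refl)             = inj₁ refl
  up (inj₂ (inj₁ (eq , lt))) = inj₂ (inj₁ (eq , s≤s lt))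
  up (inj₂ (inj₂ (eq , lt))) = inj₂ (inj₂ (cong suc eq , lt))

-- The corner and the arm contribute `p ∸ j`; the leg is column `j` of `ps`, counted by
-- `columnLength`.
hookLength-top : ∀ p ps j →
  hookLength (p ∷ ps) (0 , j) ≡ (p ∸ j) + length (filter (j <?_) ps)
hookLength-top p ps j = begin
  hookLength (p ∷ ps) (0 , j)
    ≡⟨ hookLength-split p ps (0 , j) ⟩
  length (filter (λ l → inHook? (0 , j) (0 , l)) (upTo p)) +
  length (filter (λ v → inHook? (0 , j) (map₁ suc v)) (cells ps))
    ≡⟨ cong₂ _+_
         (length-filter-cong (λ l → inHook? (0 , j) (0 , l)) (j ≤?_)
           (All.tabulate {xs = upTo p} λ _ → right , right⁻¹))
         (length-filter-cong (λ v → inHook? (0 , j) (map₁ suc v)) (λ v → proj₂ v ≟ j)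
           (All.tabulate {xs = cells ps} λ _ → below , below⁻¹)) ⟩
  length (filter (j ≤?_) (upTo p)) + length (filter (λ v → proj₂ v ≟ j) (cells ps))
    ≡⟨ cong₂ _+_ (count-≥-upTo j p) (columnLength j ps) ⟩
  (p ∸ j) + length (filter (j <?_) ps) ∎
  where
  open ≡-Reasoning
  right : ∀ {l} → InHook (0 , j) (0 , l) → j ≤ l
  right (inj₁ refl)             = ≤-refl
  right (inj₂ (inj₁ (_ , ())))
  right (inj₂ (inj₂ (_ , lt))) = ℕ.<⇒≤ lt
  right⁻¹ : ∀ {l} → j ≤ l → InHook (0 , j) (0 , l)
  right⁻¹ j≤l with ℕ.m≤n⇒m<n∨m≡n j≤l
  ... | inj₁ lt   = inj₂ (inj₂ (refl , lt))
  ... | inj₂ refl = inj₁ refl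
  below : ∀ {v} → InHook (0 , j) (map₁ suc v) → proj₂ v ≡ j
  below (inj₁ ())
  below (inj₂ (inj₁ (eq , _))) = eq
  below (inj₂ (inj₂ (() , _)))
  below⁻¹ : ∀ {v} → proj₂ v ≡ j → InHook (0 , j) (map₁ suc v)
  below⁻¹ eq = inj₂ (inj₁ (eq , s≤s z≤n))

α-∷ : ∀ k p ps → α k (p ∷ ps) ≡
  length (filter (λ j → hookLength (p ∷ ps) (0 , j) ≟ k) (upTo p)) + α k ps
α-∷ k p ps = begin
  α k (p ∷ ps)
    ≡⟨ cong length (filter-++ H? (map (0 ,_) (upTo p)) _) ⟩
  length (filter H? (map (0 ,_) (upTo p)) ++ filter H? (map (map₁ suc) (cells ps)))
    ≡⟨ length-++ (filter H? (map (0 ,_) (upTo p))) ⟩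
  length (filter H? (map (0 ,_) (upTo p))) +
  length (filter H? (map (map₁ suc) (cells ps)))
    ≡⟨ cong₂ _+_ (length-filter-map H? (0 ,_) (upTo p))
                 (length-filter-map H? (map₁ suc) (cells ps)) ⟩
  length (filter (H? ∘ (0 ,_)) (upTo p)) + length (filter (H? ∘ map₁ suc) (cells ps))
    ≡⟨ cong (length (filter (H? ∘ (0 ,_)) (upTo p)) +_)
         (length-filter-cong (H? ∘ map₁ suc) (λ u → hookLength ps u ≟ k)
           (All.tabulate {xs = cells ps} λ {u} _ →
             trans (sym (hookLength-below p ps u)) , trans (hookLength-below p ps u))) ⟩
  length (filter (H? ∘ (0 ,_)) (upTo p)) + α k ps ∎
  where
  open ≡-Reasoning
  H? : ∀ u → Dec (hookLength (p ∷ ps) u ≡ k)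
  H? u = hookLength (p ∷ ps) u ≟ k

-- The beta-set (first-column hook lengths if all parts are positive).
beads : List ℕ → List ℕ
beads []       = []
beads (p ∷ ps) = (p + length ps) ∷ beads ps

-- The gap of the bead configuration that corresponds to column j: on the
-- boundary path, j horizontal steps and the rows of length at most j precede
-- the horizontal step of column j.
gap : List ℕ → ℕ → ℕ
gap ps j = j + length (filter (_≤? j) ps)

gap-short : ∀ {p j} ps → ¬ (p ≤ j) → gap (p ∷ ps) j ≡ gap ps j
gap-short {p} {j} ps p≰j =
  cong (λ xs → j + length xs) (filter-reject (_≤? j) {xs = ps} p≰j)

count-<+≤ : ∀ j ps → length (filter (j <?_) ps) + length (filter (_≤? j) ps) ≡ length ps
count-<+≤ j ps = trans
  (cong (length (filter (j <?_) ps) +_)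
    (length-filter-cong (_≤? j) (¬? ∘ (j <?_)) (All.tabulate {xs = ps} λ _ → ℕ.≤⇒≯ , ℕ.≮⇒≥)))
  (length-filter-complement (j <?_) ps)

-- The leg counts the lower rows longer than `j`, the gap counts the others, and together these are
-- all of `ps`. Hook lengths in the top row are thus differences between the top bead and a gap.
hookLength+gap : ∀ p ps {j} → j ≤ p →
  hookLength (p ∷ ps) (0 , j) + gap ps j ≡ p + length ps
hookLength+gap p ps {j} j≤p = begin
  hookLength (p ∷ ps) (0 , j) + (j + l≤)  ≡⟨ cong (_+ (j + l≤)) (hookLength-top p ps j) ⟩
  ((p ∸ j) + l<) + (j + l≤)               ≡⟨ cong ((p ∸ j) + l< +_) (+-comm j l≤) ⟩
  ((p ∸ j) + l<) + (l≤ + j)               ≡⟨ +-assoc (p ∸ j) l< (l≤ + j) ⟩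
  (p ∸ j) + (l< + (l≤ + j))               ≡⟨ cong ((p ∸ j) +_) (+-assoc l< l≤ j) ⟨
  (p ∸ j) + ((l< + l≤) + j)               ≡⟨ cong (λ n → (p ∸ j) + (n + j)) (count-<+≤ j ps) ⟩
  (p ∸ j) + (length ps + j)               ≡⟨ cong ((p ∸ j) +_) (+-comm (length ps) j) ⟩
  (p ∸ j) + (j + length ps)               ≡⟨ +-assoc (p ∸ j) j (length ps) ⟨
  ((p ∸ j) + j) + length ps               ≡⟨ cong (_+ length ps) (ℕ.m∸n+n≡m j≤p) ⟩
  p + length ps                           ∎
  where
  open ≡-Reasoning
  l< l≤ : ℕ
  l< = length (filter (j <?_) ps)
  l≤ = length (filter (_≤? j) ps)

gap-large : ∀ {j} ps → All (_≤ j) ps → gap ps j ≡ j + length ps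
gap-large {j} ps ps≤j = cong (λ xs → j + length xs) (filter-all (_≤? j) ps≤j)

gap-mono-< : ∀ ps {i j} → i < j → gap ps i < gap ps j
gap-mono-< ps {i} {j} i<j = ℕ.+-mono-<-≤ i<j
  (length-filter-mono (_≤? i) (_≤? j) (λ p≤i → ≤-trans p≤i (ℕ.<⇒≤ i<j)) ps)

gap-injective : ∀ ps {i j} → gap ps i ≡ gap ps j → i ≡ j
gap-injective ps {i} {j} eq with ℕ.<-cmp i j
... | tri< i<j _ _ = contradiction eq (ℕ.<⇒≢ (gap-mono-< ps i<j))
... | tri≈ _ i≡j _ = i≡j
... | tri> _ _ j<i = contradiction (sym eq) (ℕ.<⇒≢ (gap-mono-< ps j<i))

beads-< : ∀ {p} ps → All (_≤ p) ps → All (_< p + length ps) (beads ps)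
beads-< []       _             = []
beads-< {p} (q ∷ ps) (q≤p ∷ ps≤p) =
  ≤-trans (s≤s (ℕ.+-monoˡ-≤ (length ps) q≤p)) (≤-reflexive (sym (+-suc p (length ps)))) ∷
  All.map (λ lt → ℕ.<-≤-trans lt (ℕ.+-monoʳ-≤ p (ℕ.n≤1+n (length ps)))) (beads-< ps ps≤p)

-- If `p ≤ j`, no row is longer than `j` and the gap lies above all beads; otherwise it is a gap of
-- `ps` below the top bead, and induction applies.
gap∉beads : ∀ {ps} → AllPairs _≥_ ps → ∀ j → gap ps j ∉ beads ps
gap∉beads {p ∷ ps} (p≥ ∷ sorted) j g∈ with p ≤? j
... | yes p≤j = ℕ.<⇒≱ (All.lookup (beads-< (p ∷ ps) (≤-refl ∷ p≥)) g∈)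
  (≤-trans (ℕ.+-monoˡ-≤ (suc (length ps)) p≤j) (≤-reflexive
    (sym (gap-large (p ∷ ps) (p≤j ∷ All.map (λ q≤p → ≤-trans q≤p p≤j) p≥)))))
... | no p≰j with subst (_∈ beads (p ∷ ps)) (gap-short ps p≰j) g∈
...   | there g∈′ = gap∉beads sorted j g∈′
...   | here eq   = ℕ.<⇒≢
  (ℕ.+-mono-<-≤ (ℕ.≰⇒> p≰j) (≤-trans (ℕ.m≤n+m _ _) (≤-reflexive (count-<+≤ j ps)))) eq

-- Above the top bead, subtracting the number of rows gives a column beyond all of them. Below it,
-- the column comes from `ps`; it is less than `p`, as otherwise its gap would reach the top bead.
gap-surjective : ∀ {ps} → AllPairs _≥_ ps → ∀ {g} → g ∉ beads ps → ∃[ j ] gap ps j ≡ g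
gap-surjective {[]}     _               {g} _  = g , ℕ.+-identityʳ g
gap-surjective {p ∷ ps} (p≥ ∷ sorted) {g} g∉ with ℕ.<-cmp g (p + length ps)
... | tri≈ _ eq _ = contradiction (here eq) g∉
... | tri> _ _ (s≤s {n = h} le) = j , (begin
  gap (p ∷ ps) j       ≡⟨ gap-large (p ∷ ps) (p≤j ∷ All.map (λ q≤p → ≤-trans q≤p p≤j) p≥) ⟩
  j + suc (length ps)  ≡⟨ +-suc j (length ps) ⟩
  suc (j + length ps)  ≡⟨ cong suc (ℕ.m∸n+n≡m (≤-trans (ℕ.m≤n+m _ p) le)) ⟩
  suc h                ∎)
  where
  open ≡-Reasoning
  j : ℕ
  j = h ∸ length ps
  p≤j : p ≤ j
  p≤j = ≤-trans (≤-reflexive (sym (ℕ.m+n∸n≡m p (length ps)))) (ℕ.∸-monoˡ-≤ (length ps) le)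
... | tri< lt _ _ with gap-surjective sorted (g∉ ∘ there)
...   | j , eq = j , trans (gap-short ps p≰j) eq
  where
  p≰j : ¬ (p ≤ j)
  p≰j p≤j = ℕ.<⇒≱ lt (≤-trans (ℕ.+-monoˡ-≤ (length ps) p≤j)
    (≤-reflexive (trans (sym (gap-large ps (All.map (λ q≤p → ≤-trans q≤p p≤j) p≥))) eq)))

-- Hooks of length `k` as beads with a gap `k` places below

module _ (k : ℕ) where

  -- In `hooks` of a decreasing list, `xs` holds just the beads below `x`. For `k > 0` the place
  -- `x ∸ k` is below `x` too, so this tests whether it is a gap of the whole configuration.
  IsHook : ℕ → List ℕ → Set
  IsHook x xs = k ≤ x × x ∸ k ∉ xs

  isHook? : ∀ x xs → Dec (IsHook x xs)
  isHook? x xs = k ≤? x ×-dec ¬? (x ∸ k ∈? xs)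

  hooks : List ℕ → List ℕ
  hooks []       = []
  hooks (x ∷ xs) with isHook? x xs
  ... | yes _ = x ∷ hooks xs
  ... | no  _ = hooks xs

  module _ .{{_ : NonZero k}} where

    -- By `hookLength+gap`, a cell of the top row has hook length `k` exactly when its gap is the
    -- top bead minus `k`. Injectivity of `gap` allows at most one such cell, and surjectivity
    -- provides it when that place is empty.
    α-beads : ∀ {ps} → AllPairs _≥_ ps → α k ps ≡ length (hooks (beads ps))
    α-beads {[]}     _               = refl
    α-beads {p ∷ ps} (p≥ ∷ sorted) = trans (α-∷ k p ps) (helper (α-beads sorted))
      where
      x : ℕ
      x = p + length ps
      toGap : ∀ {j} → j ≤ p → hookLength (p ∷ ps) (0 , j) ≡ k → k + gap ps j ≡ x
      toGap j≤p eq = trans (cong (_+ _) (sym eq)) (hookLength+gap p ps j≤p)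
      fromGap : ∀ {j} → j ≤ p → k + gap ps j ≡ x → hookLength (p ∷ ps) (0 , j) ≡ k
      fromGap j≤p eq = ℕ.+-cancelʳ-≡ (gap ps _) _ k (trans (hookLength+gap p ps j≤p) (sym eq))
      H? : ∀ j → Dec (hookLength (p ∷ ps) (0 , j) ≡ k)
      H? j = hookLength (p ∷ ps) (0 , j) ≟ k
      helper : α k ps ≡ length (hooks (beads ps)) →
               length (filter H? (upTo p)) + α k ps ≡ length (hooks (x ∷ beads ps))
      helper ih with isHook? x (beads ps)
      ... | no ¬hook = cong₂ _+_ (cong length (filter-none H? (All.map none (All.all-upTo p)))) ih
        where
        none : ∀ {j} → j < p → ¬ (hookLength (p ∷ ps) (0 , j) ≡ k)
        none {j} j<p eq = ¬hook
          ( subst (k ≤_) k+g≡x (ℕ.m≤m+n k _)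
          , subst (_∉ beads ps) (trans (sym (ℕ.m+n∸m≡n k _)) (cong (_∸ k) k+g≡x))
                  (gap∉beads sorted j))
          where
          k+g≡x : k + gap ps j ≡ x
          k+g≡x = toGap (ℕ.<⇒≤ j<p) eq
      ... | yes (k≤x , x∸k∉) with gap-surjective sorted x∸k∉
      ...   | j₀ , eq₀ = cong₂ _+_ (begin
        length (filter H? (upTo p))
          ≡⟨ length-filter-cong H? (_≟ j₀)
               (All.map (λ j<p →
                 (λ eq → gap-injective ps (ℕ.+-cancelˡ-≡ k _ _
                   (trans (toGap (ℕ.<⇒≤ j<p) eq) (sym k+g≡x)))) ,
                 (λ { refl → fromGap (ℕ.<⇒≤ j<p) k+g≡x }))
               (All.all-upTo p)) ⟩
        length (filter (_≟ j₀) (upTo p))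
          ≡⟨ count-≡-upTo j₀ p ⟩
        length (filter (j₀ <?_) (p ∷ []))
          ≡⟨ cong length (filter-accept (j₀ <?_) {xs = []} (ℕ.≰⇒> p≰j₀)) ⟩
        1 ∎) ih
        where
        open ≡-Reasoning
        k+g≡x : k + gap ps j₀ ≡ x
        k+g≡x = trans (cong (k +_) eq₀) (ℕ.m+[n∸m]≡n k≤x)
        -- A column beyond the top row would have a gap not below `x`, but this gap is `x` minus
        -- `k > 0`.
        p≰j₀ : ¬ (p ≤ j₀)
        p≰j₀ p≤j₀ = ℕ.<⇒≱ (ℕ.m<n+m (gap ps j₀) (>-nonZero⁻¹ k))
          (≤-trans (≤-reflexive k+g≡x) (≤-trans (ℕ.+-monoˡ-≤ (length ps) p≤j₀)
            (≤-reflexive (sym (gap-large ps (All.map (λ q≤p → ≤-trans q≤p p≤j₀) p≥))))))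

-- Lower bound on the size

-- Summed from the top index down, so that `sumTo f (suc n)` unfolds to `f n + sumTo f n`.
sumTo : (ℕ → ℕ) → ℕ → ℕ
sumTo f n = sum (applyDownFrom f n)

-- Induction removes the maximum `N` if it is present. The rest has length `l ≤ N`, so the new term
-- `f l` of the lower sum is at most `f N`; this is why the length bound is proved along with the
-- sum bound.
Unique-bounded : ∀ {f : ℕ → ℕ} → (∀ {i j} → i ≤ j → f i ≤ f j) → ∀ N {xs} →
  Unique xs → All (_< N) xs →
  length xs ≤ N × sumTo f (length xs) ≤ sum (map f xs)
Unique-bounded mono zero    {[]}    _ _        = z≤n , z≤n
Unique-bounded mono zero    {_ ∷ _} _ (() ∷ _)
Unique-bounded {f} mono (suc N) {xs} uniq xs< with N ∈? xs
... | no N∉ = ℕ.m≤n⇒m≤1+n (proj₁ ih) , proj₂ ih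
  where
  ih : length xs ≤ N × sumTo f (length xs) ≤ sum (map f xs)
  ih = Unique-bounded mono N uniq (All.tabulate λ {z} z∈ →
    ℕ.≤∧≢⇒< (s≤s⁻¹ (All.lookup xs< z∈)) λ { refl → N∉ z∈ })
... | yes N∈ with ∈-∃++ N∈
...   | ys , zs , refl = remove
  (Unique-resp-↭ (setoid ℕ) (↭⇒↭ₛ perm) uniq) (All-resp-↭ perm xs<)
  where
  ws : List ℕ
  ws = ys ++ zs
  perm : ys ++ N ∷ zs ↭ N ∷ ws
  perm = ↭-shift N ys zs
  remove : Unique (N ∷ ws) → All (_< suc N) (N ∷ ws) →
    length (ys ++ N ∷ zs) ≤ suc N ×
    sumTo f (length (ys ++ N ∷ zs)) ≤ sum (map f (ys ++ N ∷ zs))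
  remove (N≢ ∷ uniq′) (_ ∷ ws<)
    rewrite ↭-length perm | sum-↭ (↭-map⁺ f perm)
    with Unique-bounded mono N uniq′ (All.zipWith
           (λ (N≢z , z<) → ℕ.≤∧≢⇒< (s≤s⁻¹ z<) (N≢z ∘ sym)) (N≢ , ws<))
  ... | len≤ , sum≤ = s≤s len≤ , ℕ.+-mono-≤ (mono len≤) sum≤

sum-Unique : ∀ {f : ℕ → ℕ} → (∀ {i j} → i ≤ j → f i ≤ f j) → ∀ {xs} →
  Unique xs → sumTo f (length xs) ≤ sum (map f xs)
sum-Unique mono {xs} uniq = proj₂ (Unique-bounded mono (suc (sum xs)) uniq (bounded xs))
  where
  bounded : ∀ xs → All (_< suc (sum xs)) xs
  bounded []       = []
  bounded (x ∷ xs) = s≤s (ℕ.m≤m+n x (sum xs)) ∷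
    All.map (λ lt → ℕ.<-≤-trans lt (s≤s (ℕ.m≤n+m (sum xs) x))) (bounded xs)

sum-beads : ∀ ps → sum (beads ps) ≡ sum (downFrom (length ps)) + sum ps
sum-beads []       = refl
sum-beads (p ∷ ps) rewrite sum-beads ps = lemma p (length ps) _ _
  where
  lemma : ∀ p l d s → (p + l) + (d + s) ≡ (l + d) + (p + s)
  lemma = solve-∀

beads-sorted : ∀ {ps} → AllPairs _≥_ ps → AllPairs _>_ (beads ps)
beads-sorted []                          = []
beads-sorted {p ∷ ps} (p≥ ∷ sorted) = beads-< ps p≥ ∷ beads-sorted sorted

length-beads : ∀ ps → length (beads ps) ≡ length ps
length-beads []       = refl
length-beads (p ∷ ps) = cong suc (length-beads ps)

-- Residue classes modulo `k` and squashed lists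

module _ (k : ℕ) .{{_ : NonZero k}} where

  [c+r*k]%k : ∀ c r → c < k → (c + r * k) % k ≡ c
  [c+r*k]%k c r c<k = trans ([m+kn]%n≡m%n c r k) (m<n⇒m%n≡m c<k)

  [c+r*k]/k : ∀ c r → c < k → (c + r * k) / k ≡ r
  [c+r*k]/k c r c<k = trans (+-distrib-/-∣ʳ c (divides-refl r))
    (cong₂ _+_ (m<n⇒m/n≡0 c<k) (m*n/n≡m r k))

  /-cancelʳ-< : ∀ {z x} → z % k ≡ x % k → z < x → z / k < x / k
  /-cancelʳ-< {z} {x} eq z<x = ℕ.≰⇒> λ x/k≤z/k → ℕ.<⇒≱ z<x (begin
    x                    ≡⟨ m≡m%n+[m/n]*n x k ⟩
    x % k + x / k * k    ≤⟨ ℕ.+-mono-≤ (≤-reflexive (sym eq)) (ℕ.*-monoˡ-≤ k x/k≤z/k) ⟩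
    z % k + z / k * k    ≡⟨ m≡m%n+[m/n]*n z k ⟨
    z                    ∎)
    where open ℕ.≤-Reasoning

  class : ℕ → List ℕ → ℕ
  class c xs = length (filter (λ z → z % k ≟ c) xs)

  class-accept : ∀ {c x} xs → x % k ≡ c → class c (x ∷ xs) ≡ suc (class c xs)
  class-accept {c} xs eq = cong length (filter-accept (λ z → z % k ≟ c) {xs = xs} eq)

  class-reject : ∀ {c x} xs → ¬ (x % k ≡ c) → class c (x ∷ xs) ≡ class c xs
  class-reject {c} xs neq = cong length (filter-reject (λ z → z % k ≟ c) {xs = xs} neq)

  class-∷-≤ : ∀ c x xs → class c xs ≤ class c (x ∷ xs)
  class-∷-≤ c x xs with x % k ≟ c
  ... | yes eq = ≤-trans (ℕ.n≤1+n _) (≤-reflexive (sym (class-accept xs eq)))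
  ... | no neq = ≤-reflexive (sym (class-reject xs neq))

  -- Slide every element down its residue class, against those below it.
  squash : List ℕ → List ℕ
  squash []       = []
  squash (x ∷ xs) = (x % k + class (x % k) xs * k) ∷ squash xs

  length-squash : ∀ xs → length (squash xs) ≡ length xs
  length-squash []       = refl
  length-squash (x ∷ xs) = cong suc (length-squash xs)

  squash-< : ∀ xs → All (λ v → v / k < class (v % k) xs) (squash xs)
  squash-< []       = []
  squash-< (x ∷ xs) = head ∷
    All.map (λ {v} lt → ℕ.<-≤-trans lt (class-∷-≤ (v % k) x xs)) (squash-< xs)
    where
    c<k : x % k < k
    c<k = m%n<n x k
    head : (x % k + class (x % k) xs * k) / k <
           class ((x % k + class (x % k) xs * k) % k) (x ∷ xs)
    head rewrite [c+r*k]/k (x % k) (class (x % k) xs) c<k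
               | [c+r*k]%k (x % k) (class (x % k) xs) c<k =
      ≤-reflexive (sym (class-accept xs refl))

  -- The head is placed at height `class (x % k) xs` on its runner, and by `squash-<` every other
  -- squashed element on that runner is lower.
  squash-unique : ∀ xs → Unique (squash xs)
  squash-unique []       = []
  squash-unique (x ∷ xs) = All.map differ (squash-< xs) ∷ squash-unique xs
    where
    r : ℕ
    r = class (x % k) xs
    differ : ∀ {v} → v / k < class (v % k) xs → ¬ (x % k + r * k ≡ v)
    differ lt refl rewrite [c+r*k]/k (x % k) r (m%n<n x k)
                         | [c+r*k]%k (x % k) r (m%n<n x k) = ℕ.<-irrefl refl lt

  Below : ℕ → ℕ → List ℕ → Set
  Below c y = All (λ z → z % k ≡ c → z / k < y)

  below : ∀ {x xs} → All (_< x) xs → Below (x % k) (x / k) xs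
  below = All.map (λ z<x eq → /-cancelʳ-< eq z<x)

  -- Height `(x ∸ k) / k` is one below that of `x`, and on this runner it belongs to `x ∸ k`, which
  -- is a gap. So the bound from `below` improves by one.
  below-hook : ∀ {x xs} → All (_< x) xs → IsHook k x xs →
    Below (x % k) ((x ∸ k) / k) xs
  below-hook {x} {xs} xs<x (k≤x , x∸k∉) = All.tabulate λ {z} z∈ eq →
    ℕ.≤∧≢⇒< (s≤s⁻¹ (subst (z / k <_) (m/n≡1+[m∸n]/n k≤x) (/-cancelʳ-< eq (All.lookup xs<x z∈))))
      λ z/k≡ → x∸k∉ (subst (_∈ xs) (begin
        z                            ≡⟨ m≡m%n+[m/n]*n z k ⟩
        z % k + z / k * k            ≡⟨ cong₂ (λ c y → c + y * k)
                                          (trans eq (sym (m≤n⇒[n∸m]%m≡n%m k≤x))) z/k≡ ⟩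
        (x ∸ k) % k + (x ∸ k) / k * k ≡⟨ m≡m%n+[m/n]*n (x ∸ k) k ⟨
        x ∸ k                        ∎) z∈)
    where open ≡-Reasoning

  -- Below the top bead of a class, the beads and, right under each hook bead,
  -- a gap occupy different places.
  class-bound : ∀ {xs} → AllPairs _>_ xs → ∀ {c y} → Below c y xs →
    class c xs + class c (hooks k xs) ≤ y
  class-bound {[]}     _ _ = z≤n
  class-bound {x ∷ xs} (x> ∷ sorted) {c} {y} (x< ∷ xs<) with isHook? k x xs | x % k ≟ c
  ... | no _     | no neq = subst (λ n → n + class c (hooks k xs) ≤ y)
    (sym (class-reject xs neq)) (class-bound sorted xs<)
  ... | no _     | yes refl = subst (λ n → n + class c (hooks k xs) ≤ y)
    (sym (class-accept xs refl))
    (≤-trans (s≤s (class-bound sorted (below x>))) (x< refl))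
  ... | yes _    | no neq = subst₂ (λ m n → m + n ≤ y)
    (sym (class-reject xs neq)) (sym (class-reject (hooks k xs) neq)) (class-bound sorted xs<)
  ... | yes hook | yes refl = subst₂ (λ m n → m + n ≤ y)
    (sym (class-accept xs refl)) (sym (class-accept (hooks k xs) refl))
    (begin
      suc (class c xs + suc (class c (hooks k xs)))  ≡⟨ cong suc (+-suc _ _) ⟩
      2 + (class c xs + class c (hooks k xs))
        ≤⟨ s≤s (s≤s (class-bound sorted (below-hook x> hook))) ⟩
      2 + (x ∸ k) / k                                ≡⟨ cong suc (m/n≡1+[m∸n]/n (proj₁ hook)) ⟨
      suc (x / k)                                    ≤⟨ x< refl ⟩
      y                                              ∎)
    where open ℕ.≤-Reasoning

  -- For `i = c + h * k` with `c < k` this is `k * (h + 1)`, a lower bound for the distance of a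
  -- hook bead from its squashed place when its runner holds `h` hook beads below it.
  cost : ℕ → ℕ
  cost i = k * suc (i / k)

  cost-mono : ∀ {i j} → i ≤ j → cost i ≤ cost j
  cost-mono i≤j = ℕ.*-monoʳ-≤ k (s≤s (/-monoˡ-≤ k i≤j))

  -- Bead by bead: `class-bound` gives `r ≤ x / k`, and for a hook bead `r + h ≤ (x ∸ k) / k`. Hence
  -- a hook bead covers both its squashed place and the cost indexed by its squashed place among the
  -- hook beads.
  squash-bound : ∀ {xs} → AllPairs _>_ xs →
    sum (squash xs) + sum (map cost (squash (hooks k xs))) ≤ sum xs
  squash-bound {[]}     _               = z≤n
  squash-bound {x ∷ xs} (x> ∷ sorted) with isHook? k x xs
  ... | no _ = ≤-trans (≤-reflexive (+-assoc (c + r * k) _ _))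
    (ℕ.+-mono-≤ c+r*k≤x (squash-bound sorted))
    where
    c r : ℕ
    c = x % k
    r = class c xs
    c+r*k≤x : c + r * k ≤ x
    c+r*k≤x = ≤-trans
      (ℕ.+-monoʳ-≤ c (ℕ.*-monoˡ-≤ k (≤-trans (ℕ.m≤m+n r _) (class-bound sorted (below x>)))))
      (≤-reflexive (sym (m≡m%n+[m/n]*n x k)))
  ... | yes hook = begin
    ((c + r * k) + S) + (cost (c + h * k) + T)
      ≡⟨ cong (λ y → ((c + r * k) + S) + (k * suc y + T)) ([c+r*k]/k c h (m%n<n x k)) ⟩
    ((c + r * k) + S) + (k * suc h + T)
      ≡⟨ regroup c r k h S T ⟩
    (c + suc (r + h) * k) + (S + T)
      ≤⟨ ℕ.+-mono-≤ (ℕ.+-monoʳ-≤ c (ℕ.*-monoˡ-≤ k (s≤s (class-bound sorted (below-hook x> hook)))))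
           (squash-bound sorted) ⟩
    (c + suc ((x ∸ k) / k) * k) + sum xs
      ≡⟨ cong (λ y → (c + y * k) + sum xs) (m/n≡1+[m∸n]/n (proj₁ hook)) ⟨
    (c + x / k * k) + sum xs
      ≡⟨ cong (_+ sum xs) (m≡m%n+[m/n]*n x k) ⟨
    x + sum xs ∎
    where
    open ℕ.≤-Reasoning
    c r h S T : ℕ
    c = x % k
    r = class c xs
    h = class c (hooks k xs)
    S = sum (squash xs)
    T = sum (map cost (squash (hooks k xs)))
    regroup : ∀ c r k h S T →
      ((c + r * k) + S) + (k * suc h + T) ≡ (c + suc (r + h) * k) + (S + T)
    regroup = solve-∀

  -- The smallest size of a partition with m hooks of length k, by minSize-α and
  -- ≤b; the e m of the header.
  minSize : ℕ → ℕ
  minSize = sumTo cost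

  -- `sum-Unique` bounds both sums in `squash-bound` from below. The bound for the beads is exactly
  -- their surplus over the parts, by `sum-beads`, and cancels.
  minSize-α : ∀ {ps} → AllPairs _≥_ ps → minSize (α k ps) ≤ sum ps
  minSize-α {ps} sorted = ℕ.+-cancelˡ-≤ (sumTo id (length ps)) _ _ (begin
    sumTo id (length ps) + minSize (α k ps)
      ≡⟨ cong₂ (λ l m → sumTo id l + minSize m)
           (sym (trans (length-squash xs) (length-beads ps)))
           (trans (α-beads k sorted) (sym (length-squash (hooks k xs)))) ⟩
    sumTo id (length (squash xs)) + minSize (length (squash (hooks k xs)))
      ≤⟨ ℕ.+-mono-≤ (sum-Unique id (squash-unique xs))
                    (sum-Unique cost-mono (squash-unique (hooks k xs))) ⟩
    sum (map id (squash xs)) + sum (map cost (squash (hooks k xs)))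
      ≡⟨ cong (λ ys → sum ys + sum (map cost (squash (hooks k xs)))) (map-id (squash xs)) ⟩
    sum (squash xs) + sum (map cost (squash (hooks k xs)))
      ≤⟨ squash-bound (beads-sorted sorted) ⟩
    sum xs
      ≡⟨ sum-beads ps ⟩
    sumTo id (length ps) + sum ps ∎)
    where
    open ℕ.≤-Reasoning
    xs : List ℕ
    xs = beads ps

-- Partitions with many hooks

cells-zeros : ∀ {ps} → All (_≤ 0) ps → cells ps ≡ []
cells-zeros []                = refl
cells-zeros (z≤n ∷ zeros) = cong (map (map₁ suc)) (cells-zeros zeros)

cells-positive : ∀ {ps} → AllPairs _≥_ ps → cells (filter (0 <?_) ps) ≡ cells ps
cells-positive {[]}         _               = refl
cells-positive {zero ∷ ps}  (p≥ ∷ sorted) = trans (cells-positive sorted)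
  (trans (cells-zeros p≥) (sym (cong (map (map₁ suc)) (cells-zeros p≥))))
cells-positive {suc p ∷ ps} (_ ∷ sorted)  =
  cong (λ cs → map (0 ,_) (upTo (suc p)) ++ map (map₁ suc) cs) (cells-positive sorted)

sum-positive : ∀ ps → sum (filter (0 <?_) ps) ≡ sum ps
sum-positive []           = refl
sum-positive (zero ∷ ps)  = sum-positive ps
sum-positive (suc p ∷ ps) = cong (suc p +_) (sum-positive ps)

α≤b : ∀ k {ps} → AllPairs _≥_ ps → α k ps ≤ b (sum ps) k
α≤b k {ps} sorted = subst (_≤ b (sum ps) k) α≡ (proj₁ (b-isMax (sum ps) k) (filter (0 <?_) ps)
  ( AllPairs⇒Linked (AllPairs.filter⁺ (0 <?_) sorted)
  , All.all-filter (0 <?_) ps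
  , sum-positive ps ))
  where
  α≡ : α k (filter (0 <?_) ps) ≡ α k ps
  α≡ = cong (λ cs → length (filter (λ u → length (filter (inHook? u) cs) ≟ k) cs))
            (cells-positive sorted)

-- A part is its bead minus the number of beads below it, which turns strict decrease into weak
-- decrease.
beads-surjective : ∀ {xs} → AllPairs _>_ xs → ∃[ ps ] AllPairs _≥_ ps × beads ps ≡ xs
beads-surjective {[]}     _               = [] , [] , refl
beads-surjective {x ∷ xs} (x> ∷ sorted) with beads-surjective sorted
... | []     , _ , refl               = x ∷ [] , [] ∷ [] , cong (_∷ []) (ℕ.+-identityʳ x)
... | q ∷ qs , (q≥ ∷ sorted′) , refl = x ∸ l ∷ q ∷ qs ,
  ((q≤ ∷ All.map (λ r≤q → ≤-trans r≤q q≤) q≥) ∷ q≥ ∷ sorted′) ,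
  cong (_∷ beads (q ∷ qs)) (ℕ.m∸n+n≡m (≤-trans (ℕ.m≤n+m l q) q+l≤x))
  where
  l : ℕ
  l = suc (length qs)
  q+l≤x : q + l ≤ x
  q+l≤x = ≤-trans (≤-reflexive (+-suc q (length qs))) (All.head x>)
  q≤ : q ≤ x ∸ l
  q≤ = ≤-trans (≤-reflexive (sym (ℕ.m+n∸n≡m q l))) (ℕ.∸-monoˡ-≤ l q+l≤x)

-- Lets partitions be built as bead lists: the size `n` is the excess of the bead sum over the sum
-- of the naturals below `length xs`.
hooks≤b : ∀ k .{{_ : NonZero k}} {xs n} → AllPairs _>_ xs →
  sum xs ≡ sumTo id (length xs) + n → length (hooks k xs) ≤ b n k
hooks≤b k {xs} {n} sorted sum≡ with beads-surjective sorted
... | ps , sorted′ , refl = subst₂ (λ h m → h ≤ b m k)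
  (α-beads k sorted′)
  (ℕ.+-cancelˡ-≡ (sumTo id (length ps)) _ _
    (trans (sym (sum-beads ps)) (trans sum≡ (cong (λ l → sumTo id l + n) (length-beads ps)))))
  (α≤b k sorted′)

sumTo-+ : ∀ f m n → sumTo f (m + n) ≡ sumTo (λ i → f (i + n)) m + sumTo f n
sumTo-+ f zero    n = refl
sumTo-+ f (suc m) n = trans (cong (f (m + n) +_) (sumTo-+ f m n)) (sym (+-assoc (f (m + n)) _ _))

sumTo-cong : ∀ {f g : ℕ → ℕ} n → (∀ {i} → i < n → f i ≡ g i) → sumTo f n ≡ sumTo g n
sumTo-cong zero    eq = refl
sumTo-cong (suc n) eq = cong₂ _+_ (eq ≤-refl) (sumTo-cong n (eq ∘ ℕ.m≤n⇒m≤1+n))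

sumTo-shift : ∀ a n → sumTo (_+ a) n ≡ n * a + sumTo id n
sumTo-shift a zero    = refl
sumTo-shift a (suc n) = trans (cong (n + a +_) (sumTo-shift a n)) (lemma n a (n * a) _)
  where
  lemma : ∀ n a b t → n + a + (b + t) ≡ (a + b) + (n + t)
  lemma = solve-∀

-- Runs and layers of beads

run : ℕ → ℕ → List ℕ
run lo = applyDownFrom (_+ lo)

∉-above : ∀ {g xs} → All (_< g) xs → g ∉ xs
∉-above xs<g g∈ = ℕ.<-irrefl refl (All.lookup xs<g g∈)

∉-below : ∀ {g xs} → All (g <_) xs → g ∉ xs
∉-below xs>g g∈ = ℕ.<-irrefl refl (All.lookup xs>g g∈)

∉-++ : ∀ {g : ℕ} {xs ys} → g ∉ xs → g ∉ ys → g ∉ xs ++ ys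
∉-++ {xs = xs} g∉xs g∉ys g∈ with ∈-++⁻ xs g∈
... | inj₁ g∈xs = g∉xs g∈xs
... | inj₂ g∈ys = g∉ys g∈ys

run-≥ : ∀ lo n → All (lo ≤_) (run lo n)
run-≥ lo n = All.applyDownFrom⁺₂ (_+ lo) n (ℕ.m≤n+m lo)

run-< : ∀ lo n → All (_< n + lo) (run lo n)
run-< lo n = All.applyDownFrom⁺₁ (_+ lo) n (ℕ.+-monoˡ-< lo)

run-sorted : ∀ lo n → AllPairs _>_ (run lo n)
run-sorted lo n = AllPairs.applyDownFrom⁺₁ (_+ lo) n (λ j<i _ → ℕ.+-monoˡ-< lo j<i)

-- The interval [lo , lo + x + p] with the bead at lo + x raised by s.
layer : (lo x p s : ℕ) → List ℕ
layer lo x p s = (s + (x + lo)) ∷ run (suc x + lo) p ++ run lo x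

length-layer : ∀ lo x p s → length (layer lo x p s) ≡ suc (p + x)
length-layer lo x p s = cong suc (trans (length-++ (run (suc x + lo) p))
  (cong₂ _+_ (length-applyDownFrom _ p) (length-applyDownFrom _ x)))

sum-layer : ∀ lo x p s → sum (layer lo x p s) ≡ s + (suc (p + x) * lo + sumTo id (suc (p + x)))
sum-layer lo x p s = begin
  s + (x + lo) + sum (run (suc x + lo) p ++ run lo x)
    ≡⟨ cong (s + (x + lo) +_) (sum-++ (run (suc x + lo) p) (run lo x)) ⟩
  s + (x + lo) + (sumTo (_+ (suc x + lo)) p + sumTo (_+ lo) x)
    ≡⟨ regroup s (x + lo) (sumTo (_+ (suc x + lo)) p) (sumTo (_+ lo) x) ⟩
  s + (sumTo (_+ (suc x + lo)) p + sumTo (_+ lo) (suc x))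
    ≡⟨ cong (λ t → s + (t + sumTo (_+ lo) (suc x)))
         (sumTo-cong p (λ {i} _ → sym (+-assoc i (suc x) lo))) ⟩
  s + (sumTo (λ i → i + suc x + lo) p + sumTo (_+ lo) (suc x))
    ≡⟨ cong (s +_) (sumTo-+ (_+ lo) p (suc x)) ⟨
  s + sumTo (_+ lo) (p + suc x)
    ≡⟨ cong (λ c → s + sumTo (_+ lo) c) (+-suc p x) ⟩
  s + sumTo (_+ lo) (suc (p + x))
    ≡⟨ cong (s +_) (sumTo-shift lo (suc (p + x))) ⟩
  _ ∎
  where
  open ≡-Reasoning
  regroup : ∀ s a b c → s + a + (b + c) ≡ s + (b + (a + c))
  regroup = solve-∀

layer-≥ : ∀ lo x p s → All (lo ≤_) (layer lo x p s)
layer-≥ lo x p s = ≤-trans (ℕ.m≤n+m lo x) (ℕ.m≤n+m (x + lo) s) ∷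
  All.++⁺ (All.map (≤-trans (ℕ.m≤n+m lo (suc x))) (run-≥ (suc x + lo) p)) (run-≥ lo x)

-- The raised bead must clear the upper run, which reaches `p + (x + lo)`; for `p ≡ 0` there is
-- nothing to clear and `s` may be 0.
layer-sorted : ∀ lo x p s {ys} → p ≡ 0 ⊎ p < s → AllPairs _>_ ys → All (_< lo) ys →
  AllPairs _>_ (layer lo x p s ++ ys)
layer-sorted lo x p s {ys} p<s sorted ys<lo = AllPairs.++⁺
  (All.++⁺ (top p<s) (All.map (λ z< → ℕ.<-≤-trans z< (ℕ.m≤n+m (x + lo) s)) (run-< lo x)) ∷
   AllPairs.++⁺ (run-sorted (suc x + lo) p) (run-sorted lo x)
     (All.map (λ ≤z → All.map (λ z< → ℕ.<-≤-trans z<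
       (≤-trans (ℕ.n≤1+n (x + lo)) ≤z)) (run-< lo x)) (run-≥ (suc x + lo) p)))
  sorted
  (All.map (λ lo≤ → All.map (λ z< → ℕ.<-≤-trans z< lo≤) ys<lo) (layer-≥ lo x p s))
  where
  top : p ≡ 0 ⊎ p < s → All (_< s + (x + lo)) (run (suc x + lo) p)
  top (inj₁ refl) = []
  top (inj₂ p<s)  = All.map (λ z< → ℕ.<-≤-trans z<
      (≤-trans (≤-reflexive (+-suc p (x + lo))) (ℕ.+-monoˡ-≤ (x + lo) p<s)))
      (run-< (suc x + lo) p)

-- Packed tightly on the `l` beads of `ys`, the layer would start at `l`; starting at `lo` instead
-- moves each of its `suc (p + x)` beads by `lo − l`. The last hypothesis records the resulting size
-- without subtraction.
sum-layer-++ : ∀ lo x p s {ys l m n} → length ys ≡ l → sum ys ≡ sumTo id l + m →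
  suc (p + x) * l + n ≡ m + s + suc (p + x) * lo →
  sum (layer lo x p s ++ ys) ≡ sumTo id (length (layer lo x p s ++ ys)) + n
sum-layer-++ lo x p s {ys} {l} {m} {n} refl sum≡ eq = ℕ.+-cancelˡ-≡ (c * l) _ _ (begin
  c * l + sum (layer lo x p s ++ ys)
    ≡⟨ cong (c * l +_) (sum-++ (layer lo x p s) ys) ⟩
  c * l + (sum (layer lo x p s) + sum ys)
    ≡⟨ cong₂ (λ d y → c * l + (d + y)) (sum-layer lo x p s) sum≡ ⟩
  c * l + (s + (c * lo + sumTo id c) + (sumTo id l + m))
    ≡⟨ regroup₁ (c * l) s (c * lo) (sumTo id c) (sumTo id l) m ⟩
  c * l + sumTo id c + sumTo id l + (m + s + c * lo)
    ≡⟨ cong₂ (λ t r → t + sumTo id l + r) (sumTo-shift l c) eq ⟨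
  sumTo (_+ l) c + sumTo id l + (c * l + n)
    ≡⟨ cong (_+ (c * l + n)) (sumTo-+ id c l) ⟨
  sumTo id (c + l) + (c * l + n)
    ≡⟨ cong (λ k → sumTo id (k + l) + (c * l + n)) (length-layer lo x p s) ⟨
  sumTo id (length (layer lo x p s) + l) + (c * l + n)
    ≡⟨ cong (λ k → sumTo id k + (c * l + n)) (length-++ (layer lo x p s)) ⟨
  sumTo id (length (layer lo x p s ++ ys)) + (c * l + n)
    ≡⟨ regroup₂ _ (c * l) n ⟩
  c * l + (sumTo id (length (layer lo x p s ++ ys)) + n) ∎)
  where
  open ≡-Reasoning
  c : ℕ
  c = suc (p + x)
  regroup₁ : ∀ a s b t u m → a + (s + (b + t) + (u + m)) ≡ a + t + u + (m + s + b)
  regroup₁ = solve-∀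
  regroup₂ : ∀ t a n → t + (a + n) ≡ a + (t + n)
  regroup₂ = solve-∀

module _ (k : ℕ) .{{k≢0 : NonZero k}} where

  isHook-+ : ∀ g {xs} → g ∉ xs → IsHook k (g + k) xs
  isHook-+ g {xs} g∉ = ℕ.m≤n+m k g , subst (_∉ xs) (sym (ℕ.m+n∸n≡m g k)) g∉

  hooks-accept : ∀ {x xs} → IsHook k x xs → length (hooks k (x ∷ xs)) ≡ suc (length (hooks k xs))
  hooks-accept {x} {xs} hook with isHook? k x xs
  ... | yes _    = refl
  ... | no ¬hook = contradiction hook ¬hook

  hooks-∷-≤ : ∀ x xs → length (hooks k (x ∷ xs)) ≤ suc (length (hooks k xs))
  hooks-∷-≤ x xs with isHook? k x xs
  ... | yes _ = ≤-refl
  ... | no  _ = ℕ.n≤1+n _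

  -- As `n ≤ k`, moving a bead of the run down by `k` lands below the run, at a place `i + g` that
  -- `ys` leaves free.
  hooks-run : ∀ g n {ys} → n ≤ k → (∀ {i} → i < n → i + g ∉ ys) →
    length (hooks k (run (g + k) n ++ ys)) ≡ n + length (hooks k ys)
  hooks-run g zero    _   _  = refl
  hooks-run g (suc n) {ys} n<k g∉ = trans
    (hooks-accept (subst (λ x → IsHook k x (run (g + k) n ++ ys)) (+-assoc n g k)
      (isHook-+ (n + g) (∉-++
        (∉-below (All.map (ℕ.<-≤-trans n+g<lo) (run-≥ (g + k) n)))
        (g∉ ≤-refl)))))
    (cong suc (hooks-run g n (ℕ.<⇒≤ n<k) (g∉ ∘ ℕ.m≤n⇒m≤1+n)))
    where
    n+g<lo : n + g < g + k
    n+g<lo = ≤-trans (ℕ.+-monoˡ-< g n<k) (≤-reflexive (+-comm k g))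

  -- Every bead of the layer is a hook bead. The raised one moves down to `s + (x + g)`, which lies
  -- below the layer if `x + s < k` and is the place it vacated if `s ≡ k`. It never lands on
  -- `x + g`, so that place may be occupied.
  hooks-layer : ∀ g x p s {ys} → p + x < k → s ≤ k → x + s < k ⊎ s ≡ k →
    (∀ {i} → i < k → i ≢ x → i + g ∉ ys) → s + (x + g) ∉ ys →
    length (hooks k (layer (g + k) x p s ++ ys)) ≡ suc (p + x) + length (hooks k ys)
  hooks-layer g x p s {ys} p+x<k s≤k x+s g∉ top∉ = begin
    length (hooks k (layer (g + k) x p s ++ ys))
      ≡⟨ cong (λ xs → length (hooks k (top ∷ xs))) (++-assoc (run (suc x + (g + k)) p) _ ys) ⟩
    length (hooks k (top ∷ run (suc x + (g + k)) p ++ run (g + k) x ++ ys))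
      ≡⟨ hooks-accept (subst (λ t → IsHook k t (run (suc x + (g + k)) p ++ run (g + k) x ++ ys))
           (regroup s x g k)
           (isHook-+ (s + (x + g)) (∉-++ (∉-below top∉upper) (∉-++ (top∉lower x+s) top∉)))) ⟩
    suc (length (hooks k (run (suc x + (g + k)) p ++ run (g + k) x ++ ys)))
      ≡⟨ cong (λ lo → suc (length (hooks k (run lo p ++ run (g + k) x ++ ys))))
           (+-assoc (suc x) g k) ⟨
    suc (length (hooks k (run (suc x + g + k) p ++ run (g + k) x ++ ys)))
      ≡⟨ cong suc (hooks-run (suc x + g) p p≤k upper∉) ⟩
    suc (p + length (hooks k (run (g + k) x ++ ys)))
      ≡⟨ cong (λ h → suc (p + h)) (hooks-run g x (ℕ.<⇒≤ x<k)
           (λ i<x → g∉ (ℕ.<-trans i<x x<k) (ℕ.<⇒≢ i<x))) ⟩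
    suc (p + (x + length (hooks k ys)))
      ≡⟨ cong suc (+-assoc p x _) ⟨
    suc (p + x) + length (hooks k ys) ∎
    where
    open ≡-Reasoning
    top : ℕ
    top = s + (x + (g + k))
    p≤k : p ≤ k
    p≤k = ≤-trans (ℕ.m≤m+n p x) (ℕ.<⇒≤ p+x<k)
    x<k : x < k
    x<k = ℕ.≤-<-trans (ℕ.m≤n+m x p) p+x<k
    regroup : ∀ s x g k → s + (x + g) + k ≡ s + (x + (g + k))
    regroup = solve-∀
    regroup′ : ∀ i x g → i + suc (x + g) ≡ suc (i + x) + g
    regroup′ = solve-∀
    top<upper : s + (x + g) < suc x + (g + k)
    top<upper = s≤s (≤-trans (ℕ.+-monoˡ-≤ (x + g) s≤k)
      (≤-reflexive (trans (+-comm k (x + g)) (+-assoc x g k))))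
    top∉upper : All (s + (x + g) <_) (run (suc x + (g + k)) p)
    top∉upper = All.map (ℕ.<-≤-trans top<upper) (run-≥ (suc x + (g + k)) p)
    top∉lower : x + s < k ⊎ s ≡ k → s + (x + g) ∉ run (g + k) x
    top∉lower (inj₁ x+s<k) = ∉-below (All.map (ℕ.<-≤-trans lt) (run-≥ (g + k) x))
      where
      lt : s + (x + g) < g + k
      lt = subst₂ _<_ (trans (cong (g +_) (+-comm x s)) (trans (+-comm g (s + x)) (+-assoc s x g)))
                      refl (ℕ.+-monoʳ-< g x+s<k)
    top∉lower (inj₂ refl) = ∉-above (subst (λ h → All (_< h) (run (g + k) x)) (eq k x g) (run-< (g + k) x))
      where
      eq : ∀ k x g → x + (g + k) ≡ k + (x + g)
      eq = solve-∀
    upper∉ : ∀ {i} → i < p → i + (suc x + g) ∉ run (g + k) x ++ ys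
    upper∉ {i} i<p = subst (_∉ run (g + k) x ++ ys) (sym (regroup′ i x g)) (∉-++
      (∉-below (All.map (ℕ.<-≤-trans
        (≤-trans (ℕ.+-monoˡ-< g i+x<k) (≤-reflexive (+-comm k g)))) (run-≥ (g + k) x)))
      (g∉ i+x<k (ℕ.>⇒≢ (s≤s (ℕ.m≤n+m x i)))))
      where
      i+x<k : suc (i + x) < k
      i+x<k = ℕ.≤-<-trans (ℕ.+-monoˡ-≤ x i<p) p+x<k

  -- Every runner of the k-abacus holds a staircase of size u, on top of the
  -- core (r); this needs p + r = k − 1.
  staircase : (r p u : ℕ) → List ℕ
  staircase r p zero    = r ∷ []
  staircase r p (suc u) = layer (u * (k + k) + k) r p k ++ staircase r p u

  -- The `j` indices from `u * k` on have quotient `u`, so each costs `k * suc u`.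
  minSize-+ : ∀ u {j} → j ≤ k → minSize k (j + u * k) ≡ j * (suc u * k) + minSize k (u * k)
  minSize-+ u {zero}  _   = refl
  minSize-+ u {suc j} j<k = trans
    (cong₂ (λ q m → k * suc q + m) ([c+r*k]/k k j u j<k) (minSize-+ u (ℕ.<⇒≤ j<k)))
    (trans (sym (+-assoc (k * suc u) (j * (suc u * k)) _))
      (cong (λ c → c + j * (suc u * k) + minSize k (u * k)) (ℕ.*-comm k (suc u))))

  module _ {r p : ℕ} (k≡ : suc (p + r) ≡ k) where

    r<k : r < k
    r<k = ≤-trans (s≤s (ℕ.m≤n+m r p)) (≤-reflexive k≡)

    -- With the rows of the abacus counted from 0, the layer added at size `u` fills row `2 u + 1`,
    -- except that its bead on runner `r` stands one row higher. That bead alone lies outside the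
    -- first `2 (u + 1)` rows.
    staircase-≤ : ∀ u →
      All (λ z → z < u * (k + k) ⊎ z ≡ r + u * (k + k)) (staircase r p u)
    staircase-≤ zero    = inj₂ (sym (ℕ.+-identityʳ r)) ∷ []
    staircase-≤ (suc u) = inj₂ (regroup k r (u * (k + k))) ∷ All.++⁺
      (All.++⁺ (All.map (λ z< → inj₁ (ℕ.<-≤-trans z< (≤-reflexive upper))) (run-< _ p))
               (All.map (λ z< → inj₁ (ℕ.<-trans z< lower)) (run-< _ r)))
      (All.map (λ z → inj₁ (rest z)) (staircase-≤ u))
      where
      g : ℕ
      g = u * (k + k)
      regroup : ∀ k r g → k + (r + (g + k)) ≡ r + ((k + k) + g)
      regroup = solve-∀
      eq : ∀ k g → k + (g + k) ≡ (k + k) + g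
      eq = solve-∀
      upper : p + (suc r + (g + k)) ≡ suc u * (k + k)
      upper = trans (sym (+-assoc p (suc r) (g + k)))
        (trans (cong (_+ (g + k)) (trans (+-suc p r) k≡)) (eq k g))
      lower : r + (g + k) < suc u * (k + k)
      lower = ≤-trans (ℕ.+-monoˡ-< (g + k) r<k) (≤-reflexive (eq k g))
      rest : ∀ {z} → z < g ⊎ z ≡ r + g → z < suc u * (k + k)
      rest (inj₁ z<g)  = ℕ.<-≤-trans z<g (ℕ.m≤n+m g (k + k))
      rest (inj₂ refl) = ℕ.<-≤-trans (ℕ.+-monoˡ-< g r<k) (ℕ.+-monoˡ-≤ g (ℕ.m≤m+n k k))

    staircase-< : ∀ u → All (_< u * (k + k) + k) (staircase r p u)
    staircase-< u = All.map bound (staircase-≤ u)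
      where
      bound : ∀ {z} → z < u * (k + k) ⊎ z ≡ r + u * (k + k) → z < u * (k + k) + k
      bound (inj₁ z<)   = ℕ.<-≤-trans z< (ℕ.m≤m+n _ k)
      bound (inj₂ refl) = ≤-trans (ℕ.+-monoˡ-< _ r<k) (≤-reflexive (+-comm k _))

    length-staircase : ∀ u → length (staircase r p u) ≡ suc (u * k)
    length-staircase zero    = refl
    length-staircase (suc u) = trans (length-++ (layer _ r p k))
      (trans (cong₂ _+_ (trans (length-layer _ r p k) k≡) (length-staircase u)) (+-suc k (u * k)))

    staircase-sorted : ∀ u → AllPairs _>_ (staircase r p u)
    staircase-sorted zero    = [] ∷ []
    staircase-sorted (suc u) = layer-sorted _ r p k
      (inj₂ (≤-trans (s≤s (ℕ.m≤m+n p r)) (≤-reflexive k≡))) (staircase-sorted u) (staircase-< u)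

    sum-staircase : ∀ u → sum (staircase r p u) ≡
      sumTo id (length (staircase r p u)) + (r + minSize k (u * k))
    sum-staircase zero    = refl
    sum-staircase (suc u) = sum-layer-++ (u * (k + k) + k) r p k (length-staircase u)
      (trans (sum-staircase u) (cong (λ l → sumTo id l + (r + minSize k (u * k))) (length-staircase u)))
      (begin
        suc (p + r) * suc (u * k) + (r + minSize k (k + u * k))
          ≡⟨ cong₂ (λ c m → c * suc (u * k) + (r + m)) k≡ (minSize-+ u ≤-refl) ⟩
        k * suc (u * k) + (r + (k * (suc u * k) + minSize k (u * k)))
          ≡⟨ regroup k u r (minSize k (u * k)) ⟩
        r + minSize k (u * k) + k + k * (u * (k + k) + k)
          ≡⟨ cong (λ c → r + minSize k (u * k) + k + c * (u * (k + k) + k)) k≡ ⟨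
        r + minSize k (u * k) + k + suc (p + r) * (u * (k + k) + k) ∎)
      where
      open ≡-Reasoning
      regroup : ∀ k u r m → k * suc (u * k) + (r + (k * (suc u * k) + m)) ≡
                            r + m + k + k * (u * (k + k) + k)
      regroup = solve-∀

    -- Row `2 u` holds only the top bead, on runner `r`. So the unraised beads of the next layer
    -- have free places beneath them, the raised one has the place it vacated, and each layer adds
    -- `k` hooks.
    hooks-staircase : ∀ u → u * k ≤ length (hooks k (staircase r p u))
    hooks-staircase zero    = z≤n
    hooks-staircase (suc u) = begin
      k + u * k
        ≤⟨ ℕ.+-monoʳ-≤ k (hooks-staircase u) ⟩
      k + length (hooks k (staircase r p u))
        ≡⟨ cong (_+ length (hooks k (staircase r p u))) k≡ ⟨
      suc (p + r) + length (hooks k (staircase r p u))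
        ≡⟨ hooks-layer g r p k (≤-reflexive k≡) ≤-refl (inj₂ refl) gap∉ top∉ ⟨
      length (hooks k (staircase r p (suc u))) ∎
      where
      open ℕ.≤-Reasoning
      g : ℕ
      g = u * (k + k)
      gap∉ : ∀ {i} → i < k → i ≢ r → i + g ∉ staircase r p u
      gap∉ {i} _ i≢r i∈ with All.lookup (staircase-≤ u) i∈
      ... | inj₁ i+g<g = ℕ.<⇒≱ i+g<g (ℕ.m≤n+m g i)
      ... | inj₂ eq    = i≢r (ℕ.+-cancelʳ-≡ g i r eq)
      top∉ : k + (r + g) ∉ staircase r p u
      top∉ = ∉-above (All.map (λ z< → ℕ.<-≤-trans z<
        (≤-trans (≤-reflexive (+-comm g k)) (ℕ.+-monoʳ-≤ k (ℕ.m≤n+m g r)))) (staircase-< u))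

    -- Varying the core `(r)` realises every excess `r < k` over the minimal size.
    minSize-full : ∀ u → u * k ≤ b (r + minSize k (u * k)) k
    minSize-full u = ≤-trans (hooks-staircase u) (hooks≤b k (staircase-sorted u) (sum-staircase u))

  -- The core is `(0)`, and a partial layer of `suc (p + x)` beads is put on the staircase; raising
  -- one of them by `s` realises the excess `s`.
  minSize-partial : ∀ u x p s → suc (p + x) < k → s < k → x + s < k → p ≡ 0 ⊎ p < s →
    suc (p + x) + u * k ≤ b (s + minSize k (suc (p + x) + u * k)) k
  minSize-partial u x p s j<k s<k x+s<k p<s = begin
    suc (p + x) + u * k
      ≤⟨ ℕ.+-monoʳ-≤ (suc (p + x)) (hooks-staircase k≡ u) ⟩
    suc (p + x) + length (hooks k ys)
      ≡⟨ hooks-layer g x p s (ℕ.<⇒≤ j<k) (ℕ.<⇒≤ s<k) (inj₁ x+s<k)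
           (λ {i} _ _ → above i) (subst (_∉ ys) (+-assoc s x g) (above (s + x))) ⟨
    length (hooks k (layer (g + k) x p s ++ ys))
      ≤⟨ hooks≤b k
           (layer-sorted (g + k) x p s p<s (staircase-sorted k≡ u)
             (All.map (λ z< → ℕ.<-≤-trans z< (ℕ.m≤m+n g k)) ys<g))
           (sum-layer-++ (g + k) x p s (length-staircase k≡ u)
             (trans (sum-staircase k≡ u)
               (cong (λ l → sumTo id l + minSize k (u * k)) (length-staircase k≡ u)))
             size) ⟩
    b (s + minSize k (suc (p + x) + u * k)) k ∎
    where
    open ℕ.≤-Reasoning
    k≡ : suc (pred k + 0) ≡ k
    k≡ = trans (cong suc (ℕ.+-identityʳ (pred k))) (ℕ.suc-pred k)
    g : ℕ
    -- The first place above all beads, since with core `(0)` the top bead of the staircase is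
    -- `u * (k + k)`. A layer starting at `g + k` then adds `suc u * k` per bead, as in `minSize-+`.
    g = suc (u * (k + k))
    ys : List ℕ
    ys = staircase 0 (pred k) u
    ys<g : All (_< g) ys
    ys<g = All.map (λ { (inj₁ z<) → ℕ.m≤n⇒m≤1+n z< ; (inj₂ refl) → ≤-refl }) (staircase-≤ k≡ u)
    above : ∀ i → i + g ∉ ys
    above i = ∉-above (All.map (λ z< → ℕ.<-≤-trans z< (ℕ.m≤n+m g i)) ys<g)
    size : suc (p + x) * suc (u * k) + (s + minSize k (suc (p + x) + u * k)) ≡
           minSize k (u * k) + s + suc (p + x) * (g + k)
    size = trans
      (cong (λ m → suc (p + x) * suc (u * k) + (s + m)) (minSize-+ u (ℕ.<⇒≤ j<k)))
      (regroup (suc (p + x)) u k s (minSize k (u * k)))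
      where
      regroup : ∀ c u k s m → c * suc (u * k) + (s + (c * (suc u * k) + m)) ≡
                              m + s + c * (suc (u * (k + k)) + k)
      regroup = solve-∀

  -- Lengthening the largest part by `k` moves the top bead up by `k`, where it is a hook bead over
  -- the place it vacated. At most one hook, that of the old top bead, is lost in exchange.
  b-+k : ∀ n → b n k ≤ b (k + n) k
  b-+k n with proj₂ (b-isMax n k)
  ... | []     , _                   , eq = ≤-trans (≤-reflexive (sym eq)) z≤n
  ... | p ∷ ps , (linked , _ , refl) , eq = begin
    b n k
      ≡⟨ eq ⟨
    α k (p ∷ ps)
      ≡⟨ α-beads k (p≥ ∷ sorted) ⟩
    length (hooks k (beads (p ∷ ps)))
      ≤⟨ hooks-∷-≤ (p + length ps) (beads ps) ⟩
    suc (length (hooks k (beads ps)))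
      ≡⟨ hooks-accept raised ⟨
    length (hooks k (beads (k + p ∷ ps)))
      ≡⟨ α-beads k (p+k≥ ∷ sorted) ⟨
    α k (k + p ∷ ps)
      ≤⟨ α≤b k (p+k≥ ∷ sorted) ⟩
    b (k + p + sum ps) k
      ≡⟨ cong (λ m → b m k) (+-assoc k p (sum ps)) ⟩
    b (k + (p + sum ps)) k ∎
    where
    open ℕ.≤-Reasoning
    pairs : AllPairs _≥_ (p ∷ ps)
    pairs = Linked⇒AllPairs (flip ≤-trans) linked
    p≥ : All (_≤ p) ps
    p≥ = AllPairs.head pairs
    sorted : AllPairs _≥_ ps
    sorted = AllPairs.tail pairs
    p+k≥ : All (_≤ k + p) ps
    p+k≥ = All.map (λ q≤p → ≤-trans q≤p (ℕ.m≤n+m p k)) p≥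
    raised : IsHook k (k + p + length ps) (beads ps)
    raised = subst (λ x → IsHook k x (beads ps))
      (trans (+-comm (p + length ps) k) (sym (+-assoc k p (length ps))))
      (isHook-+ (p + length ps) (∉-above (beads-< ps p≥)))

  b-+*k : ∀ a n → b n k ≤ b (a * k + n) k
  b-+*k zero    n = ≤-refl
  b-+*k (suc a) n = ≤-trans (b-+*k a n) (≤-trans (b-+k (a * k + n))
    (≤-reflexive (cong (λ m → b m k) (sym (+-assoc k (a * k) n)))))

  -- If `j + s < k`, the last bead of the layer is raised. Otherwise `x = k − 1 − s` is the greatest
  -- admissible offset, and the remaining `p = j + s + 1 − k` is below `s` because `j + 1 < k`.
  layer-shape : ∀ {j s} → suc j < k → s < k →
    ∃[ x ] ∃[ p ] p + x ≡ j × x + s < k × (p ≡ 0 ⊎ p < s)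
  layer-shape {j} {s} 1+j<k s<k with j + s <? k
  ... | yes j+s<k = j , 0 , refl , j+s<k , inj₁ refl
  ... | no  j+s≮k = k ∸ suc s , suc (j + s) ∸ k , sum≡ ,
    ≤-reflexive (trans (sym (+-suc (k ∸ suc s) s)) (ℕ.m∸n+n≡m s<k)) ,
    inj₂ (ℕ.+-cancelʳ-< k _ _ (≤-trans (s≤s (≤-reflexive p+k≡))
      (≤-trans (ℕ.+-monoˡ-≤ s 1+j<k) (≤-reflexive (+-comm k s)))))
    where
    p+k≡ : suc (j + s) ∸ k + k ≡ suc (j + s)
    p+k≡ = ℕ.m∸n+n≡m (ℕ.m≤n⇒m≤1+n (ℕ.≮⇒≥ j+s≮k))
    sum≡ : suc (j + s) ∸ k + (k ∸ suc s) ≡ j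
    sum≡ = ℕ.+-cancelʳ-≡ (suc s) _ _ (begin
      suc (j + s) ∸ k + (k ∸ suc s) + suc s    ≡⟨ +-assoc (suc (j + s) ∸ k) _ _ ⟩
      suc (j + s) ∸ k + ((k ∸ suc s) + suc s)  ≡⟨ cong (suc (j + s) ∸ k +_) (ℕ.m∸n+n≡m s<k) ⟩
      suc (j + s) ∸ k + k                      ≡⟨ p+k≡ ⟩
      suc (j + s)                              ≡⟨ +-suc j s ⟨
      j + suc s                                ∎)
      where open ≡-Reasoning

  minSize-attained : ∀ u {j s} → j < k → s < k →
    j + u * k ≤ b (s + minSize k (j + u * k)) k
  minSize-attained u {zero} {s} _ s<k = minSize-full {s} {k ∸ suc s}
    (trans (sym (+-suc (k ∸ suc s) s)) (ℕ.m∸n+n≡m s<k)) u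
  minSize-attained u {suc j} {s} j<k s<k with layer-shape j<k s<k
  ... | x , p , refl , x+s<k , p<s = minSize-partial u x p s j<k s<k x+s<k p<s

  -- The surplus `d` of `n` over the minimal size is divided by `k`: the construction realises the
  -- remainder, and `b-+*k` adds the multiple of `k`.
  ≤b : ∀ {m n} → minSize k m ≤ n → m ≤ b n k
  ≤b {m} {n} le = subst₂ (λ i l → i ≤ b l k) (sym (m≡m%n+[m/n]*n m k)) n≡
    (≤-trans (minSize-attained (m / k) (m%n<n m k) (m%n<n d k)) (b-+*k (d / k) _))
    where
    open ≡-Reasoning
    d : ℕ
    d = n ∸ minSize k m
    n≡ : d / k * k + (d % k + minSize k (m % k + m / k * k)) ≡ n
    n≡ = begin
      d / k * k + (d % k + minSize k (m % k + m / k * k))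
        ≡⟨ +-assoc (d / k * k) (d % k) _ ⟨
      d / k * k + d % k + minSize k (m % k + m / k * k)
        ≡⟨ cong₂ (λ e i → e + minSize k i)
             (trans (+-comm (d / k * k) (d % k)) (sym (m≡m%n+[m/n]*n d k)))
             (sym (m≡m%n+[m/n]*n m k)) ⟩
      d + minSize k m
        ≡⟨ ℕ.m∸n+n≡m le ⟩
      n ∎

  minSize-mono : ∀ {i j} → i ≤ j → minSize k i ≤ minSize k j
  minSize-mono {i} {j} i≤j = ≤-trans (ℕ.m≤n+m _ _)
    (≤-reflexive (trans (sym (sumTo-+ (cost k) (j ∸ i) i)) (cong (minSize k) (ℕ.m∸n+n≡m i≤j))))

  minSize-b : ∀ n → minSize k (b n k) ≤ n
  minSize-b n with proj₂ (b-isMax n k)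
  ... | ps , (linked , _ , refl) , eq = subst (λ m → minSize k m ≤ sum ps) eq
    (minSize-α k (Linked⇒AllPairs (flip ≤-trans) linked))

-- Power series

open import Data.Integer.Base using (+_)

sumℤ : (ℕ → ℤ) → ℕ → ℤ
sumℤ F n = ∑[ i < n ] F (toℕ i)

sumℤ-cong : ∀ {F G : ℕ → ℤ} n → (∀ {i} → i < n → F i ≡ G i) → sumℤ F n ≡ sumℤ G n
sumℤ-cong {F} {G} n eq = sum-cong-≗ {n} {λ i → F (toℕ i)} {λ i → G (toℕ i)} (λ i → eq (toℕ<n i))

sumℤ-zero : ∀ n → sumℤ (λ _ → 0ℤ) n ≡ 0ℤ
sumℤ-zero zero    = refl
sumℤ-zero (suc n) = trans (ℤ.+-identityˡ _) (sumℤ-zero n)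

sumℤ-one : ∀ n → sumℤ (λ _ → 1ℤ) n ≡ + n
sumℤ-one zero    = refl
sumℤ-one (suc n) = cong (ℤ._+_ 1ℤ) (sumℤ-one n)

sumℤ-+ : ∀ (F : ℕ → ℤ) m n → sumℤ F (m + n) ≡ sumℤ F m ℤ.+ sumℤ (λ i → F (m + i)) n
sumℤ-+ F zero    n = sym (ℤ.+-identityˡ _)
sumℤ-+ F (suc m) n = trans (cong (ℤ._+_ (F 0)) (sumℤ-+ (F ∘ suc) m n)) (sym (ℤ.+-assoc (F 0) _ _))

sumℤ-* : ∀ (F : ℕ → ℤ) m k → sumℤ (λ t → sumℤ (λ j → F (j + t * k)) k) m ≡ sumℤ F (m * k)
sumℤ-* F zero    k = refl
sumℤ-* F (suc m) k = sym (trans (sumℤ-+ F k (m * k)) (cong₂ ℤ._+_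
  (sumℤ-cong k (λ {j} _ → cong F (sym (ℕ.+-identityʳ j))))
  (trans (sym (sumℤ-* (λ i → F (k + i)) m k))
    (sumℤ-cong m (λ {t} _ → sumℤ-cong k (λ {j} _ → cong F (lemma k j (t * k))))))))
  where
  lemma : ∀ k j a → k + (j + a) ≡ j + (k + a)
  lemma = solve-∀

sumℤ-⊖ : ∀ (F G : ℕ → ℤ) n → sumℤ (λ i → F i ℤ.- G i) n ≡ sumℤ F n ℤ.- sumℤ G n
sumℤ-⊖ F G zero    = refl
sumℤ-⊖ F G (suc n) = trans (cong (ℤ._+_ (F 0 ℤ.- G 0)) (sumℤ-⊖ (F ∘ suc) (G ∘ suc) n))
  (lemma (F 0) (G 0) _ _)
  where
  lemma : ∀ a b c d → (a ℤ.- b) ℤ.+ (c ℤ.- d) ≡ (a ℤ.+ c) ℤ.- (b ℤ.+ d)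
  lemma = ℤ.solve-∀

-- Multiplication by `q^ m`, see `q^-⊛`; the recursive form makes its laws plain inductions without
-- convolution sums.
shift : ℕ → PowerSeries → PowerSeries
shift zero    f n       = f n
shift (suc m) f zero    = 0ℤ
shift (suc m) f (suc n) = shift m f n

shift-cong : ∀ m {f g} → f ≈ g → shift m f ≈ shift m g
shift-cong zero    eq n       = eq n
shift-cong (suc m) eq zero    = refl
shift-cong (suc m) eq (suc n) = shift-cong m eq n

shift-⊖ : ∀ m f g → shift m (f ⊖ g) ≈ shift m f ⊖ shift m g
shift-⊖ zero    f g n       = refl
shift-⊖ (suc m) f g zero    = refl
shift-⊖ (suc m) f g (suc n) = shift-⊖ m f g n

shift-sum : ∀ m (F : ℕ → PowerSeries) k →
  shift m (λ n → sumℤ (λ j → F j n) k) ≈ λ n → sumℤ (λ j → shift m (F j) n) k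
shift-sum zero    F k n       = refl
shift-sum (suc m) F k zero    = sym (sumℤ-zero k)
shift-sum (suc m) F k (suc n) = shift-sum m F k n

shift-shift : ∀ a m f → shift a (shift m f) ≈ shift (a + m) f
shift-shift zero    m f n       = refl
shift-shift (suc a) m f zero    = refl
shift-shift (suc a) m f (suc n) = shift-shift a m f n

shift-q^ : ∀ a m → shift a (q^ m) ≈ q^ (a + m)
shift-q^ zero    m n       = refl
shift-q^ (suc a) m zero    = refl
shift-q^ (suc a) m (suc n) = shift-q^ a m n

q^-⊛ : ∀ m f → q^ m ⊛ f ≈ shift m f
q^-⊛ zero    f n       = trans
  (cong₂ ℤ._+_ (ℤ.*-identityˡ (f n))
    (trans (sumℤ-cong n (λ {i} _ → ℤ.*-zeroˡ (f (n ∸ suc i)))) (sumℤ-zero n)))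
  (ℤ.+-identityʳ (f n))
q^-⊛ (suc m) f zero    = cong (ℤ._+ 0ℤ) (ℤ.*-zeroˡ (f 0))
-- `does (suc i ≟ suc m)` reduces to `does (i ≟ m)`, so the tail of the convolution is
-- `(q^ m ⊛ f) n` definitionally.
q^-⊛ (suc m) f (suc n) = trans
  (cong₂ ℤ._+_ (ℤ.*-zeroˡ (f (suc n))) (q^-⊛ m f n)) (ℤ.+-identityˡ _)

1-q^-⊛ : ∀ m f → (𝟙 ⊖ q^ m) ⊛ f ≈ f ⊖ shift m f
1-q^-⊛ m f n = begin
  sumℤ (λ i → (𝟙 i ℤ.- (q^ m) i) ℤ.* f (n ∸ i)) (suc n)
    ≡⟨ sumℤ-cong (suc n) (λ {i} _ → lemma (𝟙 i) ((q^ m) i) (f (n ∸ i))) ⟩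
  sumℤ (λ i → 𝟙 i ℤ.* f (n ∸ i) ℤ.- (q^ m) i ℤ.* f (n ∸ i)) (suc n)
    ≡⟨ sumℤ-⊖ (λ i → 𝟙 i ℤ.* f (n ∸ i)) (λ i → (q^ m) i ℤ.* f (n ∸ i)) (suc n) ⟩
  (𝟙 ⊛ f) n ℤ.- (q^ m ⊛ f) n
    ≡⟨ cong₂ ℤ._-_ (q^-⊛ 0 f n) (q^-⊛ m f n) ⟩
  f n ℤ.- shift m f n ∎
  where
  open ≡-Reasoning
  lemma : ∀ a b c → (a ℤ.- b) ℤ.* c ≡ a ℤ.* c ℤ.- b ℤ.* c
  lemma = ℤ.solve-∀

-- Geometric series and partial sums

module _ (m : ℕ) .{{_ : NonZero m}} where

  private
    geometric : PowerSeries
    geometric = inv (𝟙 ⊖ q^ m)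

  geometric-shift : geometric ⊖ shift m geometric ≈ 𝟙
  geometric-shift n = trans (sym (1-q^-⊛ m geometric n))
    (⊛-inverseʳ (𝟙 ⊖ q^ m) (1-qᵐ-constant m) n)

  -- Telescoping: with `G` the full geometric series, `G` minus its shift by `(l + 1) m` is `G`
  -- minus its shift by `m`, which is `𝟙`, plus the shift by `m` of the case `l`.
  geometric-partial : ∀ l → (𝟙 ⊖ q^ (l * m)) ⊘ (𝟙 ⊖ q^ m) ≈
    λ n → sumℤ (λ j → (q^ (j * m)) n) l
  geometric-partial l n = trans (1-q^-⊛ (l * m) geometric n) (telescope l n)
    where
    open ≡-Reasoning
    split : ∀ a b c → a ℤ.- c ≡ (a ℤ.- b) ℤ.+ (b ℤ.- c)
    split = ℤ.solve-∀
    telescope : ∀ l → geometric ⊖ shift (l * m) geometric ≈ λ n → sumℤ (λ j → (q^ (j * m)) n) l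
    telescope zero    n = ℤ.+-inverseʳ (geometric n)
    telescope (suc l) n = begin
      geometric n ℤ.- shift (m + l * m) geometric n
        ≡⟨ split (geometric n) (shift m geometric n) _ ⟩
      (geometric n ℤ.- shift m geometric n) ℤ.+
      (shift m geometric n ℤ.- shift (m + l * m) geometric n)
        ≡⟨ cong₂ (λ x y → x ℤ.+ (shift m geometric n ℤ.- y))
             (geometric-shift n) (sym (shift-shift m (l * m) geometric n)) ⟩
      𝟙 n ℤ.+ (shift m geometric n ℤ.- shift m (shift (l * m) geometric) n)
        ≡⟨ cong (ℤ._+_ (𝟙 n)) (shift-⊖ m geometric (shift (l * m) geometric) n) ⟨
      𝟙 n ℤ.+ shift m (geometric ⊖ shift (l * m) geometric) n
        ≡⟨ cong (ℤ._+_ (𝟙 n)) (shift-cong m (telescope l) n) ⟩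
      𝟙 n ℤ.+ shift m (λ n → sumℤ (λ j → (q^ (j * m)) n) l) n
        ≡⟨ cong (ℤ._+_ (𝟙 n)) (shift-sum m (λ j → q^ (j * m)) l n) ⟩
      𝟙 n ℤ.+ sumℤ (λ j → shift m (q^ (j * m)) n) l
        ≡⟨ cong (ℤ._+_ (𝟙 n)) (sumℤ-cong l (λ {j} _ → shift-q^ m (j * m) n)) ⟩
      sumℤ (λ j → (q^ (j * m)) n) (suc l) ∎

-- Division by `1 − q`, see `prefix-⊛`.
prefix : PowerSeries → PowerSeries
prefix f zero    = f 0
prefix f (suc n) = f (suc n) ℤ.+ prefix f n

1/[1-q] : 𝟙 ⊘ (𝟙 ⊖ q^ 1) ≈ λ _ → 1ℤ
1/[1-q] n = trans (q^-⊛ 0 (inv (𝟙 ⊖ q^ 1)) n) (ones n)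
  where
  lemma : ∀ a b → a ≡ (a ℤ.- b) ℤ.+ b
  lemma = ℤ.solve-∀
  ones : inv (𝟙 ⊖ q^ 1) ≈ λ _ → 1ℤ
  ones zero    = refl
  -- Consecutive coefficients differ by a coefficient of `𝟙` of positive index, which is 0.
  ones (suc n) = trans (lemma (inv (𝟙 ⊖ q^ 1) (suc n)) (inv (𝟙 ⊖ q^ 1) n))
    (cong₂ ℤ._+_ (geometric-shift 1 (suc n)) (ones n))

prefix-⊛ : ∀ f → (𝟙 ⊘ (𝟙 ⊖ q^ 1)) ⊛ f ≈ prefix f
prefix-⊛ f n = trans
  (sumℤ-cong (suc n) (λ {i} _ → trans
    (cong (ℤ._* f (n ∸ i)) (1/[1-q] i)) (ℤ.*-identityˡ (f (n ∸ i))))) (reverse n)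
  where
  reverse : ∀ n → sumℤ (λ i → f (n ∸ i)) (suc n) ≡ prefix f n
  reverse zero    = ℤ.+-identityʳ (f 0)
  reverse (suc n) = cong (ℤ._+_ (f (suc n))) (reverse n)

prefix-cong : ∀ {f g} n → (∀ {i} → i ≤ n → f i ≡ g i) → prefix f n ≡ prefix g n
prefix-cong zero    eq = eq ≤-refl
prefix-cong (suc n) eq = cong₂ ℤ._+_ (eq ≤-refl) (prefix-cong n (eq ∘ ℕ.m≤n⇒m≤1+n))

prefix-⊖ : ∀ f g → prefix (f ⊖ g) ≈ prefix f ⊖ prefix g
prefix-⊖ f g zero    = refl
prefix-⊖ f g (suc n) = trans (cong (ℤ._+_ (f (suc n) ℤ.- g (suc n))) (prefix-⊖ f g n))
  (lemma (f (suc n)) (g (suc n)) (prefix f n) (prefix g n))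
  where
  lemma : ∀ a b c d → (a ℤ.- b) ℤ.+ (c ℤ.- d) ≡ (a ℤ.+ c) ℤ.- (b ℤ.+ d)
  lemma = ℤ.solve-∀

prefix-sum : ∀ (F : ℕ → PowerSeries) k →
  prefix (λ n → sumℤ (λ j → F j n) k) ≈ λ n → sumℤ (λ j → prefix (F j) n) k
prefix-sum F k zero    = refl
prefix-sum F k (suc n) = trans (cong (ℤ._+_ (sumℤ (λ j → F j (suc n)) k)) (prefix-sum F k n))
  (sym (∑-distrib-+ {k} (λ j → F (toℕ j) (suc n)) (λ j → prefix (F (toℕ j)) n)))

q^-≡ : ∀ m → (q^ m) m ≡ 1ℤ
q^-≡ m = cong (if_then 1ℤ else 0ℤ) (dec-true (m ≟ m) refl)

q^-≢ : ∀ {m n} → n ≢ m → (q^ m) n ≡ 0ℤ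
q^-≢ {m} {n} n≢m = cong (if_then 1ℤ else 0ℤ) (dec-false (n ≟ m) n≢m)

prefix-q^-< : ∀ {m n} → n < m → prefix (q^ m) n ≡ 0ℤ
prefix-q^-< {n = zero}  n<m = q^-≢ (ℕ.<⇒≢ n<m)
prefix-q^-< {n = suc n} n<m =
  cong₂ ℤ._+_ (q^-≢ (ℕ.<⇒≢ n<m)) (prefix-q^-< (ℕ.<-trans (ℕ.n<1+n n) n<m))

prefix-q^-≤ : ∀ {m n} → m ≤ n → prefix (q^ m) n ≡ 1ℤ
prefix-q^-≤ {n = zero}  z≤n = refl
prefix-q^-≤ {m} {suc n} m≤ with ℕ.m≤n⇒m<n∨m≡n m≤
... | inj₁ m<  = cong₂ ℤ._+_ (q^-≢ (ℕ.>⇒≢ m<)) (prefix-q^-≤ (s≤s⁻¹ m<))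
... | inj₂ refl = cong₂ ℤ._+_ (q^-≡ m) (prefix-q^-< {m} {n} ≤-refl)

-- The exponents of the series and comparison of coefficients

module _ (k : ℕ) .{{k≢0 : NonZero k}} where

  -- Block `t` of `k` indices costs `suc t * k ^ 2`, and Pascal's rule adds this up.
  minSize-*k : ∀ t → minSize k (t * k) ≡ (suc t C 2) * k ^ 2
  minSize-*k zero    = refl
  minSize-*k (suc t) = begin
    minSize k (k + t * k)
      ≡⟨ minSize-+ k t ≤-refl ⟩
    k * (suc t * k) + minSize k (t * k)
      ≡⟨ cong₂ (λ a m → k * (a * k) + m) (sym (nC1≡n (suc t))) (minSize-*k t) ⟩
    k * ((suc t C 1) * k) + (suc t C 2) * k ^ 2
      ≡⟨ lemma k (suc t C 1) (suc t C 2) ⟩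
    ((suc t C 1) + (suc t C 2)) * k ^ 2
      ≡⟨ cong (_* k ^ 2) (nCk+nC[k+1]≡[n+1]C[k+1] (suc t) 1) ⟩
    (suc (suc t) C 2) * k ^ 2 ∎
    where
    open ≡-Reasoning
    lemma : ∀ k a c → k * (a * k) + c * (k * (k * 1)) ≡ (a + c) * (k * (k * 1))
    lemma = solve-∀

  -- Since `suc t * k ^ 2` is `k` times `suc t * k`, the quotient is a geometric sum of `k` terms.
  -- Shifted by `minSize k (t * k)`, its exponents are the minimal sizes for the block of indices
  -- from `t * k` on.
  term-sum : ∀ t → term k (suc t) ≈ λ n → sumℤ (λ j → (q^ (minSize k (j + t * k))) n) k
  term-sum t n = begin
    term k (suc t) n
      ≡⟨ q^-⊛ a _ n ⟩
    shift a ((𝟙 ⊖ q^ (suc t * k ^ 2)) ⊘ (𝟙 ⊖ q^ m)) n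
      ≡⟨ cong (λ l → shift a ((𝟙 ⊖ q^ l) ⊘ (𝟙 ⊖ q^ m)) n) (lemma k (suc t)) ⟩
    shift a ((𝟙 ⊖ q^ (k * m)) ⊘ (𝟙 ⊖ q^ m)) n
      ≡⟨ shift-cong a (geometric-partial m {{m≢0}} k) n ⟩
    shift a (λ n → sumℤ (λ j → (q^ (j * m)) n) k) n
      ≡⟨ shift-sum a (λ j → q^ (j * m)) k n ⟩
    sumℤ (λ j → shift a (q^ (j * m)) n) k
      ≡⟨ sumℤ-cong k (λ {j} j<k → trans (shift-q^ a (j * m) n) (cong (λ l → (q^ l) n) (begin
           a + j * m                      ≡⟨ +-comm a (j * m) ⟩
           j * m + a                      ≡⟨ cong (_+_ (j * m)) (minSize-*k t) ⟨
           j * m + minSize k (t * k)      ≡⟨ minSize-+ k t (ℕ.<⇒≤ j<k) ⟨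
           minSize k (j + t * k)          ∎))) ⟩
    sumℤ (λ j → (q^ (minSize k (j + t * k))) n) k ∎
    where
    open ≡-Reasoning
    a m : ℕ
    a = (suc t C 2) * k ^ 2
    m = suc t * k
    m≢0 : NonZero m
    m≢0 = ℕ.m*n≢0 (suc t) k
    lemma : ∀ k t → t * (k * (k * 1)) ≡ k * (t * k)
    lemma = solve-∀

  m≤minSize : ∀ m → m ≤ minSize k m
  m≤minSize zero    = z≤n
  m≤minSize (suc m) = ℕ.+-mono-≤ (>-nonZero⁻¹ (cost k m) {{ℕ.m*n≢0 k _}}) (m≤minSize m)

theorem1p2 : ∀ (k : ℕ) .{{_ : NonZero k}} →
    (λ n → + (b n k)) ≈
    (𝟙 ⊘ (𝟙 ⊖ q^ 1)) ⊛
    (∑≥1 (λ t → q^ ((t C 2) * k ^ 2) ⊛ ((𝟙 ⊖ q^ (t * k ^ 2)) ⊘ (𝟙 ⊖ q^ (t * k))))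
    (term-summable k)
    ⊖ 𝟙)
theorem1p2 k n = sym (begin
  ((𝟙 ⊘ (𝟙 ⊖ q^ 1)) ⊛ (∑≥1 (term k) (term-summable k) ⊖ 𝟙)) n
    ≡⟨ prefix-⊛ _ n ⟩
  prefix (∑≥1 (term k) (term-summable k) ⊖ 𝟙) n
    ≡⟨ prefix-⊖ _ 𝟙 n ⟩
  prefix (∑≥1 (term k) (term-summable k)) n ℤ.- prefix 𝟙 n
    ≡⟨ cong₂ ℤ._-_ (prefix-cong n series) (prefix-q^-≤ {0} {n} z≤n) ⟩
  prefix (λ l → sumℤ (λ i → (q^ (minSize k i)) l) N) n ℤ.- 1ℤ
    ≡⟨ cong (ℤ._- 1ℤ) (prefix-sum (λ i → q^ (minSize k i)) N n) ⟩
  sumℤ (λ i → prefix (q^ (minSize k i)) n) N ℤ.- 1ℤ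
    -- The indices up to `B` have `minSize k i ≤ n` and contribute 1 each, the later ones 0. The
    -- final `− 1` takes away the index 0.
    ≡⟨ cong (λ M → sumℤ (λ i → prefix (q^ (minSize k i)) n) M ℤ.- 1ℤ) (ℕ.m+[n∸m]≡n b<N) ⟨
  sumℤ (λ i → prefix (q^ (minSize k i)) n) (suc B + (N ∸ suc B)) ℤ.- 1ℤ
    ≡⟨ cong (ℤ._- 1ℤ) (sumℤ-+ (λ i → prefix (q^ (minSize k i)) n) (suc B) (N ∸ suc B)) ⟩
  sumℤ (λ i → prefix (q^ (minSize k i)) n) (suc B) ℤ.+
  sumℤ (λ i → prefix (q^ (minSize k (suc B + i))) n) (N ∸ suc B) ℤ.- 1ℤ
    ≡⟨ cong₂ (λ x y → x ℤ.+ y ℤ.- 1ℤ)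
         (trans (sumℤ-cong (suc B) (λ i≤B → prefix-q^-≤ (small i≤B))) (sumℤ-one (suc B)))
         (trans (sumℤ-cong (N ∸ suc B) (λ {i} _ → prefix-q^-< (large i))) (sumℤ-zero (N ∸ suc B))) ⟩
  + suc B ℤ.+ 0ℤ ℤ.- 1ℤ
    ≡⟨ cong (ℤ._- 1ℤ) (ℤ.+-identityʳ (+ suc B)) ⟩
  + B ∎)
  where
  open ≡-Reasoning
  B N : ℕ
  B = b n k
  -- The terms `1, …, n + 1` of the series determine all coefficients up to `n`, and each consists
  -- of `k` powers of `q`.
  N = suc n * k
  b<N : suc B ≤ N
  b<N = ≤-trans (s≤s (≤-trans (m≤minSize k B) (minSize-b k n))) (ℕ.m≤m*n (suc n) k)
  small : ∀ {i} → i < suc B → minSize k i ≤ n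
  small i≤B = ≤-trans (minSize-mono k (s≤s⁻¹ i≤B)) (minSize-b k n)
  large : ∀ i → n < minSize k (suc B + i)
  large i = ℕ.≰⇒> λ le → ℕ.<⇒≱ (s≤s (ℕ.m≤m+n B i)) (≤b k le)
  series : ∀ {l} → l ≤ n → ∑≥1 (term k) (term-summable k) l ≡
    sumℤ (λ i → (q^ (minSize k i)) l) N
  series {l} l≤n = begin
    ∑≥1 (term k) (term-summable k) l
      ≡⟨ ∑∞-limit (term k ∘ suc) (term-summable k) l (suc n) (s≤s l≤n) ⟨
    sumℤ (λ t → term k (suc t) l) (suc n)
      ≡⟨ sumℤ-cong (suc n) (λ {t} _ → term-sum k t l) ⟩
    sumℤ (λ t → sumℤ (λ j → (q^ (minSize k (j + t * k))) l) k) (suc n)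
      ≡⟨ sumℤ-* (λ i → (q^ (minSize k i)) l) (suc n) k ⟩
    sumℤ (λ i → (q^ (minSize k i)) l) N ∎
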